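{- If $L_1$ and $L_2$ are (disjoint) Tr-lattices, then $L_1*L_2$ is a Tr-lattice.
   Context: All matroids and lattices are finite. A flat $X$ of a matroid $M$ is cyclic if $M|X$ has no isthmuses; the cyclic flats ordered by inclusion form a lattice $\mathcal{Z}(M)$. A lattice $L$ is a Tr-lattice if every matroid $M$ with $\mathcal{Z}(M)$ isomorphic to $L$ is transversal. For disjoint lattices $L_1,L_2$ with greatest elements $\hat{1}_{L_1},\hat{1}_{L_2}$, the lattice $L_1*L_2$ has underlying set $(L_1\cup L_2\cup\{\hat{0},\hat{1}\})-\{\hat{1}_{L_1},\hat{1}_{L_2}\}$, where $\hat 0,\hat 1$ are two new elements, and $x\le y$ if and only if (i) $y=\hat{1}$, or (ii) $x=\hat{0}$, or (iii) for some $i\in\{1,2\}$, both $x,y\in L_i$ and $x\le y$ in $L_i$. -}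

module Defs where

open import Data.Nat using (ℕ; _≤_; _<_)
open import Data.Fin using (Fin)
open import Data.Fin.Subset using (Subset; _∈_; _∉_; _⊆_; _∪_; _-_; ⁅_⁆; ∣_∣)
  renaming (⊥ to ∅)
open import Data.Product using (Σ; ∃; ∃-syntax; _×_; _,_)
open import Data.Unit using (⊤; tt)
open import Data.Empty using (⊥)
open import Relation.Nullary using (¬_)
open import Relation.Binary.PropositionalEquality using (_≡_)
open import Relation.Binary.Lattice.Structures using (IsBoundedLattice)
open import Function.Bundles using (_↔_; _⇔_)

record Matroid (n : ℕ) : Set₁ where
  field
    Indep      : Subset n → Set
    indep-∅    : Indep ∅
    indep-⊆    : ∀ {X Y} → X ⊆ Y → Indep Y → Indep X
    augment    : ∀ {X Y} → Indep X → Indep Y → ∣ X ∣ < ∣ Y ∣ →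
                 ∃[ e ] (e ∈ Y × e ∉ X × Indep (X ∪ ⁅ e ⁆))

module _ {n : ℕ} (M : Matroid n) where
  open Matroid M

  IsRank : Subset n → ℕ → Set
  IsRank X k = (∃[ I ] (I ⊆ X × Indep I × ∣ I ∣ ≡ k))
             × (∀ I → I ⊆ X → Indep I → ∣ I ∣ ≤ k)

  InClosure : Subset n → Fin n → Set
  InClosure X e = ∃[ k ] (IsRank X k × IsRank (X ∪ ⁅ e ⁆) k)

  IsFlat : Subset n → Set
  IsFlat X = ∀ e → InClosure X e → e ∈ X

  IsBasisOf : Subset n → Subset n → Set
  IsBasisOf X B = B ⊆ X × Indep B
                × (∀ B' → B ⊆ B' → B' ⊆ X → Indep B' → B' ⊆ B)

  IsIsthmusOfRestriction : Subset n → Fin n → Set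
  IsIsthmusOfRestriction X e = e ∈ X × (∀ B → IsBasisOf X B → e ∈ B)

  IsCyclicFlat : Subset n → Set
  IsCyclicFlat X = IsFlat X × (∀ e → ¬ IsIsthmusOfRestriction X e)

  IsPartialTransversal : {k : ℕ} → (Fin k → Subset n) → Subset n → Set
  IsPartialTransversal {k} A I =
    Σ (Fin n → Fin k) λ φ → ((∀ e → e ∈ I → e ∈ A (φ e))
           × (∀ e f → e ∈ I → f ∈ I → φ e ≡ φ f → e ≡ f))

  IsTransversal : Set
  IsTransversal = ∃[ k ] Σ (Fin k → Subset n) λ A →
                    ∀ I → (Indep I ⇔ IsPartialTransversal A I)

  ZIsoTo : (C : Set) → (C → C → Set) → Set
  ZIsoTo C _≼_ = Σ (C → Subset n) λ f →
      (∀ a → IsCyclicFlat (f a))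
    × (∀ X → IsCyclicFlat X → ∃[ a ] (f a ≡ X))
    × (∀ a b → f a ≡ f b → a ≡ b)
    × (∀ a b → (a ≼ b) ⇔ (f a ⊆ f b))

record FinLattice : Set₁ where
  field
    Carrier   : Set
    _≤L_      : Carrier → Carrier → Set
    _∨_ _∧_   : Carrier → Carrier → Carrier
    top bot   : Carrier
    isBoundedLattice : IsBoundedLattice {A = Carrier} _≡_ _≤L_ _∨_ _∧_ top bot
    size      : ℕ
    finite    : Carrier ↔ Fin size

IsTrOrder : (C : Set) → (C → C → Set) → Set₁
IsTrOrder C _≼_ = ∀ (n : ℕ) (M : Matroid n) → ZIsoTo M C _≼_ → IsTransversal M

IsTrLattice : FinLattice → Set₁
IsTrLattice L = IsTrOrder (FinLattice.Carrier L) (FinLattice._≤L_ L)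

-- The lattice L₁ * L₂ (the disjoint union makes L₁, L₂ disjoint).

module _ (L₁ L₂ : FinLattice) where
  private
    module L₁ = FinLattice L₁
    module L₂ = FinLattice L₂

  data Star : Set where
    s0  : Star
    s1  : Star
    inl : (x : L₁.Carrier) → ¬ (x ≡ L₁.top) → Star
    inr : (y : L₂.Carrier) → ¬ (y ≡ L₂.top) → Star

  _≤*_ : Star → Star → Set
  _       ≤* s1      = ⊤
  s0      ≤* _       = ⊤
  inl x _ ≤* inl y _ = x L₁.≤L y
  inr x _ ≤* inr y _ = x L₂.≤L y
  _       ≤* _       = ⊥

{-# OPTIONS --safe #-}
module Submission where

-- Write r for the rank function of M, U for the greatest cyclic flat, Z₀ for the least one, and
-- Zᵢ for the image of the bottom of Lᵢ.  The cyclic flats of M/Zᵢ are those of M containing Zᵢ,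
-- hence form a copy of Lᵢ, so M/Zᵢ has a presentation Aᵢ.  Then M is presented by A₁ together
-- with A₂, r Z₁ + r Z₂ - r U copies of U - Z₀, and one singleton for each element outside U.
-- That independent sets are partial transversals is Hall's condition, which follows from the
-- submodularity of r applied to J ∪ Z₁ and J ∪ Z₂, because r (Z₁ ∪ Z₂) = r U.  Conversely, a cyclic
-- set X meets exactly r X members of any presentation, so by counting a cyclic flat X of M meets
-- at most r X of the sets above and cannot contain a matched circuit spanning it.
--
-- Independence in M is not assumed decidable.  Its decidability is extracted from the hypothesis
-- on L₁, see tr-stable.

open import Data.Bool using (true; false; if_then_else_)
import Data.Bool as Bool
open import Data.Empty using (⊥; ⊥-elim)
open import Data.Nat using (ℕ; zero; suc; _+_; _∸_; _≤_; _<_; z≤n; s≤s; _≤?_; _<?_)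
open import Data.Nat.Properties hiding (_≟_; 0≢1+n; suc-injective)
open import Data.Fin using (Fin; zero; suc; _↑ˡ_; _↑ʳ_; splitAt)
open import Data.Fin.Properties using (any?; _≟_; 0≢1+n; suc-injective; splitAt-↑ˡ; splitAt⁻¹-↑ˡ; splitAt⁻¹-↑ʳ)
open import Data.Fin.Subset using (Subset; inside; outside; _∈_; _∉_; _⊆_; _∪_; _∩_; _─_; _-_; ⁅_⁆; ∣_∣; Nonempty) renaming (⊥ to ∅; ⊤ to full)
open import Data.Fin.Subset.Properties
open import Data.Product using (Σ; ∃; ∃-syntax; _×_; _,_; proj₁; proj₂)
open import Data.Sum using (_⊎_; inj₁; inj₂; [_,_]′)
open import Data.Unit using (tt)
open import Data.Vec using ([]; _∷_; _++_; tabulate; here; there)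
open import Data.Vec.Properties using (lookup∘tabulate; lookup⇒[]=; []=⇒lookup; zipWith-++; lookup-++ˡ; lookup-++ʳ; ≡-dec)
open import Function using (_∘_; id; const; _⇔_; mk⇔; Equivalence; Inverse)
open import Function.Construct.Composition using (_⇔-∘_)
open import Function.Properties.Inverse using (↔⇒↣)
open import Relation.Nullary using (¬_; Dec; yes; no; does; contradiction; ¬?; _×-dec_)
open import Relation.Nullary.Decidable using (dec-true; decidable-stable; map′; via-injection; ¬¬-excluded-middle)
open import Relation.Unary using (Decidable)
open import Relation.Binary.Definitions using (DecidableEquality)
open import Relation.Binary.Lattice.Structures using (IsBoundedLattice)
open import Relation.Binary.PropositionalEquality
open import Algebra.Properties.CommutativeSemigroup +-commutativeSemigroup using (xy∙z≈xz∙y) renaming (interchange to +-interchange)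
import Data.Nat as ℕ
open import Defs

private
  variable
    n k l : ℕ

-- Finite subsets and their cardinalities.

select : {P : Fin n → Set} → Decidable P → Subset n
select P? = tabulate (does ∘ P?)

module _ {P : Fin n → Set} (P? : Decidable P) where

  ∈-select⁺ : ∀ {x} → P x → x ∈ select P?
  ∈-select⁺ {x} px = lookup⇒[]= x _ (trans (lookup∘tabulate _ x) (dec-true (P? x) px))

  ∈-select⁻ : ∀ {x} → x ∈ select P? → P x
  ∈-select⁻ {x} x∈ with P? x | trans (sym (lookup∘tabulate (does ∘ P?) x)) ([]=⇒lookup x∈)
  ... | yes px | _ = px
  ... | no  _  | ()

∣p∪q∣+∣p∩q∣≡∣p∣+∣q∣ : (p q : Subset n) → ∣ p ∪ q ∣ + ∣ p ∩ q ∣ ≡ ∣ p ∣ + ∣ q ∣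
∣p∪q∣+∣p∩q∣≡∣p∣+∣q∣ [] [] = refl
∣p∪q∣+∣p∩q∣≡∣p∣+∣q∣ (true ∷ p) (true ∷ q) = cong suc (trans (+-suc _ _)
  (trans (cong suc (∣p∪q∣+∣p∩q∣≡∣p∣+∣q∣ p q)) (sym (+-suc _ _))))
∣p∪q∣+∣p∩q∣≡∣p∣+∣q∣ (true ∷ p) (false ∷ q) = cong suc (∣p∪q∣+∣p∩q∣≡∣p∣+∣q∣ p q)
∣p∪q∣+∣p∩q∣≡∣p∣+∣q∣ (false ∷ p) (true ∷ q) =
  trans (cong suc (∣p∪q∣+∣p∩q∣≡∣p∣+∣q∣ p q)) (sym (+-suc _ _))
∣p∪q∣+∣p∩q∣≡∣p∣+∣q∣ (false ∷ p) (false ∷ q) = ∣p∪q∣+∣p∩q∣≡∣p∣+∣q∣ p q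

∣p∪q∣≤∣p∣+∣q∣ : (p q : Subset n) → ∣ p ∪ q ∣ ≤ ∣ p ∣ + ∣ q ∣
∣p∪q∣≤∣p∣+∣q∣ p q = ≤-trans (m≤m+n _ _) (≤-reflexive (∣p∪q∣+∣p∩q∣≡∣p∣+∣q∣ p q))

∣p∩q∣+∣p─q∣≡∣p∣ : (p q : Subset n) → ∣ p ∩ q ∣ + ∣ p ─ q ∣ ≡ ∣ p ∣
∣p∩q∣+∣p─q∣≡∣p∣ [] [] = refl
∣p∩q∣+∣p─q∣≡∣p∣ (true ∷ p) (true ∷ q) = cong suc (∣p∩q∣+∣p─q∣≡∣p∣ p q)
∣p∩q∣+∣p─q∣≡∣p∣ (true ∷ p) (false ∷ q) = trans (+-suc _ _) (cong suc (∣p∩q∣+∣p─q∣≡∣p∣ p q))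
∣p∩q∣+∣p─q∣≡∣p∣ (false ∷ p) (true ∷ q) = ∣p∩q∣+∣p─q∣≡∣p∣ p q
∣p∩q∣+∣p─q∣≡∣p∣ (false ∷ p) (false ∷ q) = ∣p∩q∣+∣p─q∣≡∣p∣ p q

x∈p─q⇒x∉q : {x : Fin n} (p q : Subset n) → x ∈ p ─ q → x ∉ q
x∈p─q⇒x∉q (_ ∷ p) (true ∷ q) (there x∈) (there x∈q) = x∈p─q⇒x∉q p q x∈ x∈q
x∈p─q⇒x∉q (_ ∷ p) (false ∷ q) (there x∈) (there x∈q) = x∈p─q⇒x∉q p q x∈ x∈q

x∈p-y⇒x≢y : {x : Fin n} (p : Subset n) (y : Fin n) → x ∈ p - y → x ≢ y
x∈p-y⇒x≢y p y x∈ refl = x∈p─q⇒x∉q p ⁅ y ⁆ x∈ (x∈⁅x⁆ y)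

∣p∣≤1+∣p-x∣ : (p : Subset n) (x : Fin n) → ∣ p ∣ ≤ suc ∣ p - x ∣
∣p∣≤1+∣p-x∣ p x = begin
  ∣ p ∣                       ≡⟨ ∣p∩q∣+∣p─q∣≡∣p∣ p ⁅ x ⁆ ⟨
  ∣ p ∩ ⁅ x ⁆ ∣ + ∣ p - x ∣   ≤⟨ +-monoˡ-≤ _ (∣p∩q∣≤∣q∣ p ⁅ x ⁆) ⟩
  ∣ ⁅ x ⁆ ∣ + ∣ p - x ∣       ≡⟨ cong (_+ ∣ p - x ∣) (∣⁅x⁆∣≡1 x) ⟩
  suc ∣ p - x ∣               ∎
  where open ≤-Reasoning

∪-lub : {p q r : Subset n} → p ⊆ r → q ⊆ r → p ∪ q ⊆ r
∪-lub {p = p} {q} p⊆r q⊆r x∈ = [ (λ x∈p → p⊆r x∈p) , (λ x∈q → q⊆r x∈q) ]′ (x∈p∪q⁻ p q x∈)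

⁅⁆-⊆ : {x : Fin n} {p : Subset n} → x ∈ p → ⁅ x ⁆ ⊆ p
⁅⁆-⊆ {x = x} {p} x∈p y∈ = subst (_∈ p) (sym (x∈⁅y⁆⇒x≡y x y∈)) x∈p

p⊆p-x∪⁅x⁆ : (p : Subset n) (x : Fin n) → p ⊆ (p - x) ∪ ⁅ x ⁆
p⊆p-x∪⁅x⁆ p x {y} y∈p with y ≟ x
... | yes refl = q⊆p∪q (p - x) ⁅ x ⁆ (x∈⁅x⁆ x)
... | no y≢x = p⊆p∪q ⁅ x ⁆ (x∈p∧x≢y⇒x∈p-y y∈p y≢x)

∣p∪⁅x⁆∣≡1+∣p∣ : (p : Subset n) {x : Fin n} → x ∉ p → ∣ p ∪ ⁅ x ⁆ ∣ ≡ suc ∣ p ∣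
∣p∪⁅x⁆∣≡1+∣p∣ p {x} x∉p = ≤-antisym
  (≤-trans (∣p∪q∣≤∣p∣+∣q∣ p ⁅ x ⁆) (≤-reflexive (trans (cong (∣ p ∣ +_) (∣⁅x⁆∣≡1 x)) (+-comm _ 1))))
  (p⊂q⇒∣p∣<∣q∣ (p⊆p∪q ⁅ x ⁆ , x , q⊆p∪q p ⁅ x ⁆ (x∈⁅x⁆ x) , x∉p))

⊈⇒∃ : (p q : Subset n) → ¬ (p ⊆ q) → ∃[ x ] (x ∈ p × x ∉ q)
⊈⇒∃ p q p⊈q with any? (λ x → (x ∈? p) ×-dec ¬? (x ∈? q))
... | yes found = found
... | no none = ⊥-elim (p⊈q sub)
  where
  sub : p ⊆ q
  sub {x} x∈p with x ∈? q
  ... | yes x∈q = x∈q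
  ... | no x∉q = ⊥-elim (none (x , x∈p , x∉q))

subset-induction : (Q : Subset k → Set) → Q ∅ → (∀ {p q} → Q p → Q q → Q (p ∪ q)) →
                   (p : Subset k) → (∀ {x} → x ∈ p → Q ⁅ x ⁆) → Q p
subset-induction Q Q∅ Q∪ [] Q⁅⁆ = Q∅
subset-induction Q Q∅ Q∪ (s ∷ p) Q⁅⁆ = add s Q⁅⁆
  where
  rest : (∀ {x} → x ∈ s ∷ p → Q ⁅ x ⁆) → Q (outside ∷ p)
  rest h = subset-induction (Q ∘ (outside ∷_)) Q∅ Q∪ p (λ x∈p → h (there x∈p))
  add : ∀ t → (∀ {x} → x ∈ t ∷ p → Q ⁅ x ⁆) → Q (t ∷ p)
  add false h = rest Q⁅⁆
  add true  h = subst (Q ∘ (inside ∷_)) (∪-identityˡ p) (Q∪ (h here) (rest Q⁅⁆))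

-- Set systems, neighbourhoods and matchings.

-- Set systems are recorded dually: Γ e is the set of indices of the members that contain e.
nbhd : (Fin n → Subset k) → Subset n → Subset k
nbhd Γ []          = ∅
nbhd Γ (true  ∷ J) = Γ zero ∪ nbhd (Γ ∘ suc) J
nbhd Γ (false ∷ J) = nbhd (Γ ∘ suc) J

∈-nbhd⁺ : (Γ : Fin n → Subset k) {J : Subset n} {e : Fin n} {i : Fin k} → e ∈ J → i ∈ Γ e → i ∈ nbhd Γ J
∈-nbhd⁺ Γ {true ∷ J} here i∈ = p⊆p∪q _ i∈
∈-nbhd⁺ Γ {true ∷ J} (there e∈J) i∈ = q⊆p∪q (Γ zero) _ (∈-nbhd⁺ (Γ ∘ suc) e∈J i∈)
∈-nbhd⁺ Γ {false ∷ J} (there e∈J) i∈ = ∈-nbhd⁺ (Γ ∘ suc) e∈J i∈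

∈-nbhd⁻ : (Γ : Fin n → Subset k) (J : Subset n) {i : Fin k} → i ∈ nbhd Γ J → ∃[ e ] (e ∈ J × i ∈ Γ e)
∈-nbhd⁻ Γ [] i∈ = ⊥-elim (∉⊥ i∈)
∈-nbhd⁻ Γ (true ∷ J) i∈ with x∈p∪q⁻ (Γ zero) _ i∈
... | inj₁ i∈Γ0 = zero , here , i∈Γ0
... | inj₂ i∈N = let e , e∈J , i∈Γe = ∈-nbhd⁻ (Γ ∘ suc) J i∈N in suc e , there e∈J , i∈Γe
∈-nbhd⁻ Γ (false ∷ J) i∈ = let e , e∈J , i∈Γe = ∈-nbhd⁻ (Γ ∘ suc) J i∈ in suc e , there e∈J , i∈Γe

nbhd-⊆ : (Γ : Fin n → Subset k) (J : Subset n) {S : Subset k} → (∀ {e} → e ∈ J → Γ e ⊆ S) → nbhd Γ J ⊆ S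
nbhd-⊆ Γ J h i∈ = let e , e∈J , i∈Γe = ∈-nbhd⁻ Γ J i∈ in h e∈J i∈Γe

nbhd-mono : (Γ : Fin n → Subset k) {J K : Subset n} → J ⊆ K → nbhd Γ J ⊆ nbhd Γ K
nbhd-mono Γ {J} J⊆K = nbhd-⊆ Γ J λ e∈J → ∈-nbhd⁺ Γ (J⊆K e∈J)

∅-++ : ∀ k l → ∅ {k + l} ≡ ∅ {k} ++ ∅ {l}
∅-++ zero    l = refl
∅-++ (suc k) l = cong (outside ∷_) (∅-++ k l)

nbhd-++ : (Γ : Fin n → Subset k) (Δ : Fin n → Subset l) (J : Subset n) →
          nbhd (λ e → Γ e ++ Δ e) J ≡ nbhd Γ J ++ nbhd Δ J
nbhd-++ {k = k} {l} Γ Δ [] = ∅-++ k l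
nbhd-++ Γ Δ (true ∷ J) = trans (cong (_ ∪_) (nbhd-++ (Γ ∘ suc) (Δ ∘ suc) J)) (zipWith-++ _ (Γ zero) _ _ _)
nbhd-++ Γ Δ (false ∷ J) = nbhd-++ (Γ ∘ suc) (Δ ∘ suc) J

∣p++q∣≡∣p∣+∣q∣ : (p : Subset k) (q : Subset l) → ∣ p ++ q ∣ ≡ ∣ p ∣ + ∣ q ∣
∣p++q∣≡∣p∣+∣q∣ []          q = refl
∣p++q∣≡∣p∣+∣q∣ (true  ∷ p) q = cong suc (∣p++q∣≡∣p∣+∣q∣ p q)
∣p++q∣≡∣p∣+∣q∣ (false ∷ p) q = ∣p++q∣≡∣p∣+∣q∣ p q

∣nbhd-++∣ : (Γ : Fin n → Subset k) (Δ : Fin n → Subset l) (J : Subset n) →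
            ∣ nbhd (λ e → Γ e ++ Δ e) J ∣ ≡ ∣ nbhd Γ J ∣ + ∣ nbhd Δ J ∣
∣nbhd-++∣ Γ Δ J = trans (cong ∣_∣ (nbhd-++ Γ Δ J)) (∣p++q∣≡∣p∣+∣q∣ (nbhd Γ J) (nbhd Δ J))

Matching : (Fin n → Subset k) → Subset n → (Fin n → Fin k) → Set
Matching Γ I φ = (∀ e → e ∈ I → φ e ∈ Γ e) × (∀ e f → e ∈ I → f ∈ I → φ e ≡ φ f → e ≡ f)

∣∣-injection : (φ : Fin n → Fin k) (J : Subset n) (S : Subset k) → (∀ e → e ∈ J → φ e ∈ S) →
               (∀ e f → e ∈ J → f ∈ J → φ e ≡ φ f → e ≡ f) → ∣ J ∣ ≤ ∣ S ∣
∣∣-injection φ [] S into inj = z≤n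
∣∣-injection φ (true ∷ J) S into inj = ≤-trans (s≤s (∣∣-injection (φ ∘ suc) J (S - φ zero)
    (λ e e∈J → x∈p∧x≢y⇒x∈p-y (into (suc e) (there e∈J)) (λ eq → 0≢1+n (sym (inj (suc e) zero (there e∈J) here eq))))
    (λ e f e∈J f∈J eq → suc-injective (inj (suc e) (suc f) (there e∈J) (there f∈J) eq))))
  (x∈p⇒∣p-x∣<∣p∣ (into zero here))
∣∣-injection φ (false ∷ J) S into inj = ∣∣-injection (φ ∘ suc) J S
  (λ e e∈J → into (suc e) (there e∈J))
  (λ e f e∈J f∈J eq → suc-injective (inj (suc e) (suc f) (there e∈J) (there f∈J) eq))

matching⇒∣∣≤ : (Γ : Fin n → Subset k) (I : Subset n) (φ : Fin n → Fin k) → Matching Γ I φ →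
               (J : Subset n) → J ⊆ I → ∣ J ∣ ≤ ∣ nbhd Γ J ∣
matching⇒∣∣≤ Γ I φ (into , inj) J J⊆I = ∣∣-injection φ J (nbhd Γ J)
  (λ e e∈J → ∈-nbhd⁺ Γ e∈J (into e (J⊆I e∈J)))
  (λ e f e∈J f∈J → inj e f (J⊆I e∈J) (J⊆I f∈J))

-- Hall's theorem

HallCondition : (Fin n → Subset k) → Subset n → Set
HallCondition Γ I = ∀ J → J ⊆ I → ∣ J ∣ ≤ ∣ nbhd Γ J ∣

-- J is tight when |J| = |Γ(J)|; by submodularity of |Γ(·)| tight sets are closed under union.
-- If no partner for the element with neighbourhood S preserved Hall's condition on I, the
-- obstructions would unite to a tight set whose neighbourhood contains S.
module _ (Γ : Fin n → Subset k) (I : Subset n) (hallI : HallCondition Γ I) where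

  CoveredByTight : Subset k → Set
  CoveredByTight S = ∃[ T ] (T ⊆ I × ∣ nbhd Γ T ∣ ≤ ∣ T ∣ × S ⊆ nbhd Γ T)

  CoveredByTight-∪ : ∀ {p q} → CoveredByTight p → CoveredByTight q → CoveredByTight (p ∪ q)
  CoveredByTight-∪ (T , T⊆I , tT , p⊆) (T′ , T′⊆I , tT′ , q⊆) =
    T ∪ T′ , ∪-lub T⊆I T′⊆I , +-cancelʳ-≤ ∣ T ∩ T′ ∣ _ _ tight ,
    ∪-lub (⊆-trans p⊆ (nbhd-mono Γ {T} (p⊆p∪q T′))) (⊆-trans q⊆ (nbhd-mono Γ (q⊆p∪q T T′)))
    where
    open ≤-Reasoning
    N = nbhd Γ
    N∪ : N (T ∪ T′) ⊆ N T ∪ N T′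
    N∪ = nbhd-⊆ Γ (T ∪ T′) λ e∈ i∈ → x∈p∪q⁺
      ([ (λ e∈T → inj₁ (∈-nbhd⁺ Γ e∈T i∈)) , (λ e∈T′ → inj₂ (∈-nbhd⁺ Γ e∈T′ i∈)) ]′ (x∈p∪q⁻ T T′ e∈))
    N∩ : N (T ∩ T′) ⊆ N T ∩ N T′
    N∩ i∈ = x∈p∩q⁺ (nbhd-mono Γ (p∩q⊆p T T′) i∈ , nbhd-mono Γ (p∩q⊆q T T′) i∈)
    tight : ∣ N (T ∪ T′) ∣ + ∣ T ∩ T′ ∣ ≤ ∣ T ∪ T′ ∣ + ∣ T ∩ T′ ∣
    tight = begin
      ∣ N (T ∪ T′) ∣ + ∣ T ∩ T′ ∣         ≤⟨ +-monoʳ-≤ _ (hallI (T ∩ T′) (⊆-trans (p∩q⊆p T T′) T⊆I)) ⟩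
      ∣ N (T ∪ T′) ∣ + ∣ N (T ∩ T′) ∣     ≤⟨ +-mono-≤ (p⊆q⇒∣p∣≤∣q∣ N∪) (p⊆q⇒∣p∣≤∣q∣ N∩) ⟩
      ∣ N T ∪ N T′ ∣ + ∣ N T ∩ N T′ ∣     ≡⟨ ∣p∪q∣+∣p∩q∣≡∣p∣+∣q∣ (N T) (N T′) ⟩
      ∣ N T ∣ + ∣ N T′ ∣                  ≤⟨ +-mono-≤ tT tT′ ⟩
      ∣ T ∣ + ∣ T′ ∣                      ≡⟨ ∣p∪q∣+∣p∩q∣≡∣p∣+∣q∣ T T′ ⟨
      ∣ T ∪ T′ ∣ + ∣ T ∩ T′ ∣             ∎

  -- Such a `J` violates Hall's condition once `i` is removed from every neighbourhood because
  -- another element has taken it.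
  Obstruction : Fin k → Subset n → Set
  Obstruction i J = J ⊆ I × ∣ nbhd Γ J - i ∣ < ∣ J ∣

  obstruction? : ∀ i → Dec (∃ (Obstruction i))
  obstruction? i = anySubset? λ J → (J ⊆? I) ×-dec (∣ nbhd Γ J - i ∣ <? ∣ J ∣)

  -- Removing `i` costs at most one neighbour, so Hall's condition on `J` can break only if it was
  -- tight and `i` was among the neighbours of `J`.
  obstruction⇒covered : ∀ i → ∃ (Obstruction i) → CoveredByTight ⁅ i ⁆
  obstruction⇒covered i (J , J⊆I , small) = J , J⊆I , ≤-trans (∣p∣≤1+∣p-x∣ (nbhd Γ J) i) small , ⁅⁆-⊆ i∈N
    where
    N⊆ : i ∉ nbhd Γ J → nbhd Γ J ⊆ nbhd Γ J - i
    N⊆ i∉ j∈ = x∈p∧x≢y⇒x∈p-y j∈ λ { refl → i∉ j∈ }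
    i∈N : i ∈ nbhd Γ J
    i∈N with i ∈? nbhd Γ J
    ... | yes i∈ = i∈
    ... | no i∉ = contradiction (≤-trans (hallI J J⊆I) (p⊆q⇒∣p∣≤∣q∣ (N⊆ i∉))) (<⇒≱ small)

  partner : (S : Subset k) → (∀ T → T ⊆ I → ∣ T ∣ < ∣ S ∪ nbhd Γ T ∣) →
            ∃[ i ] (i ∈ S × ¬ ∃ (Obstruction i))
  partner S big with any? (λ i → (i ∈? S) ×-dec ¬? (obstruction? i))
  ... | yes found = found
  ... | no none = contradiction (big T T⊆I) (≤⇒≯ (≤-trans (p⊆q⇒∣p∣≤∣q∣ (∪-lub S⊆N ⊆-refl)) tT))
    where
    blocked : ∀ {i} → i ∈ S → CoveredByTight ⁅ i ⁆
    blocked {i} i∈S with obstruction? i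
    ... | yes obs = obstruction⇒covered i obs
    ... | no ¬obs = ⊥-elim (none (i , i∈S , ¬obs))
    covered : CoveredByTight S
    covered = subset-induction CoveredByTight (∅ , ⊥⊆ , hall-∅ , ⊥⊆) CoveredByTight-∪ S blocked
      where
      hall-∅ : ∣ nbhd Γ ∅ ∣ ≤ ∣ ∅ {n} ∣
      hall-∅ = ≤-trans (p⊆q⇒∣p∣≤∣q∣ {q = ∅} (nbhd-⊆ Γ ∅ λ e∈ → ⊥-elim (∉⊥ e∈)))
                       (≤-trans (≤-reflexive (∣⊥∣≡0 k)) z≤n)
    T = proj₁ covered
    T⊆I : T ⊆ I
    T⊆I = proj₁ (proj₂ covered)
    tT = proj₁ (proj₂ (proj₂ covered))
    S⊆N : S ⊆ nbhd Γ T
    S⊆N = proj₂ (proj₂ (proj₂ covered))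

-- Induction on the ground set: an element of `I` receives a partner free of obstructions, which is
-- then deleted from the other neighbourhoods. The third argument supplies values off `I`, since a
-- matching is a total function.
hall : (Γ : Fin n → Subset k) (I : Subset n) → (Fin n → Fin k) → HallCondition Γ I → ∃ (Matching Γ I)
hall Γ [] d h = (λ ()) , (λ ()) , λ ()
hall Γ (false ∷ I) d h =
  let φ , into , inj = hall (Γ ∘ suc) I (d ∘ suc) (λ J J⊆I → h (false ∷ J) (out⊆ J⊆I))
  in (λ { zero → d zero ; (suc e) → φ e })
   , (λ { (suc e) (there e∈I) → into e e∈I })
   , λ { (suc e) (suc f) (there e∈I) (there f∈I) eq → cong suc (inj e f e∈I f∈I eq) }
hall {k = k} Γ (true ∷ I) d h = extend (partner Γ′ I hall′ (Γ zero) (λ T T⊆I → h (true ∷ T) (in⊆in T⊆I)))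
  where
  Γ′ = Γ ∘ suc
  hall′ : HallCondition Γ′ I
  hall′ J J⊆I = h (false ∷ J) (out⊆ J⊆I)
  extend : ∃[ i ] (i ∈ Γ zero × ¬ ∃ (Obstruction Γ′ I hall′ i)) → ∃ (Matching Γ (true ∷ I))
  extend (i , i∈ , ¬obs) = ψ , into′ , inj′
    where
    Γ″ = λ e → Γ′ e - i
    N-i : ∀ J → nbhd Γ′ J - i ⊆ nbhd Γ″ J
    N-i J {j} j∈ = let e , e∈J , j∈Γ = ∈-nbhd⁻ Γ′ J (p─q⊆p _ _ j∈)
                   in ∈-nbhd⁺ Γ″ e∈J (x∈p∧x≢y⇒x∈p-y j∈Γ (x∈p-y⇒x≢y _ i j∈))
    IH = hall Γ″ I (d ∘ suc) (λ J J⊆I → ≤-trans (≮⇒≥ (λ lt → ¬obs (J , J⊆I , lt))) (p⊆q⇒∣p∣≤∣q∣ (N-i J)))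
    φ = proj₁ IH
    into = proj₁ (proj₂ IH)
    inj = proj₂ (proj₂ IH)
    ψ : Fin _ → Fin k
    ψ zero = i
    ψ (suc e) = φ e
    into′ : ∀ e → e ∈ true ∷ I → ψ e ∈ Γ e
    into′ zero _ = i∈
    into′ (suc e) (there e∈I) = p─q⊆p _ _ (into e e∈I)
    inj′ : ∀ e f → e ∈ true ∷ I → f ∈ true ∷ I → ψ e ≡ ψ f → e ≡ f
    inj′ zero zero _ _ _ = refl
    inj′ zero (suc f) _ (there f∈I) eq = ⊥-elim (x∈p-y⇒x≢y _ i (into f f∈I) (sym eq))
    inj′ (suc e) zero (there e∈I) _ eq = ⊥-elim (x∈p-y⇒x≢y _ i (into e e∈I) eq)
    inj′ (suc e) (suc f) (there e∈I) (there f∈I) eq = cong suc (inj e f e∈I f∈I eq)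

-- Maximal subsets with a decidable property.

⊆∧∣∣≤⇒⊇ : (p q : Subset n) → p ⊆ q → ∣ q ∣ ≤ ∣ p ∣ → q ⊆ p
⊆∧∣∣≤⇒⊇ p q p⊆q q≤p {x} x∈q with x ∈? p
... | yes x∈p = x∈p
... | no x∉p = contradiction q≤p (<⇒≱ (p⊂q⇒∣p∣<∣q∣ (p⊆q , x , x∈q , x∉p)))

∪-mono : {p p′ q q′ : Subset n} → p ⊆ p′ → q ⊆ q′ → p ∪ q ⊆ p′ ∪ q′
∪-mono {p′ = p′} {q′ = q′} p⊆ q⊆ = ∪-lub (⊆-trans p⊆ (p⊆p∪q q′)) (⊆-trans q⊆ (q⊆p∪q p′ q′))

module _ {P : Subset n → Set} (P? : Decidable P) (X : Subset n) where

  Maximal : Subset n → Set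
  Maximal B = ∀ e → e ∈ X → e ∉ B → ¬ P (B ∪ ⁅ e ⁆)

  -- Greedy extension: `m` bounds the number of elements of `X` still missing, so at zero `I`
  -- already contains `X`.
  extend-fuel : ∀ m I → ∣ X ∣ ≤ m + ∣ I ∣ → I ⊆ X → P I → ∃[ B ] (I ⊆ B × B ⊆ X × P B × Maximal B)
  extend-fuel zero I bound I⊆X pI =
    I , ⊆-refl , I⊆X , pI , λ e e∈X e∉I _ → e∉I (⊆∧∣∣≤⇒⊇ I X I⊆X bound e∈X)
  extend-fuel (suc m) I bound I⊆X pI
    with any? (λ e → (e ∈? X) ×-dec (¬? (e ∈? I) ×-dec P? (I ∪ ⁅ e ⁆)))
  ... | no none = I , ⊆-refl , I⊆X , pI , λ e e∈X e∉I p → none (e , e∈X , e∉I , p)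
  ... | yes (e , e∈X , e∉I , p) =
    let B , I′⊆B , rest = extend-fuel m (I ∪ ⁅ e ⁆) bound′ (∪-lub I⊆X (⁅⁆-⊆ e∈X)) p
    in B , ⊆-trans (p⊆p∪q ⁅ e ⁆) I′⊆B , rest
    where
    bound′ : ∣ X ∣ ≤ m + ∣ I ∪ ⁅ e ⁆ ∣
    bound′ = ≤-trans bound (≤-reflexive (trans (sym (+-suc m _)) (cong (m +_) (sym (∣p∪⁅x⁆∣≡1+∣p∣ I e∉I)))))

  extend : ∀ I → I ⊆ X → P I → ∃[ B ] (I ⊆ B × B ⊆ X × P B × Maximal B)
  extend I = extend-fuel ∣ X ∣ I (m≤m+n _ _)

-- Rank functions

-- Matroids by their rank axioms: independence turns into an equality of numbers and so is
-- decidable.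
record RankFunction (n : ℕ) : Set where
  field
    r        : Subset n → ℕ
    r≤∣∣     : ∀ X → r X ≤ ∣ X ∣
    r-mono   : ∀ {X Y} → X ⊆ Y → r X ≤ r Y
    r-submod : ∀ X Y → r (X ∪ Y) + r (X ∩ Y) ≤ r X + r Y

  r-∪-≤ : ∀ X Y → r (X ∪ Y) ≤ r X + ∣ Y ∣
  r-∪-≤ X Y = ≤-trans (m≤m+n _ _) (≤-trans (r-submod X Y) (+-monoʳ-≤ (r X) (r≤∣∣ Y)))

  -- `A` spans `C`, hence so does the larger `B`: submodularity for `B` and `C`, whose intersection
  -- contains `A`.
  r-absorb : ∀ {A B C} → A ⊆ B → A ⊆ C → r C ≤ r A → r (B ∪ C) ≤ r B
  r-absorb {A} {B} {C} A⊆B A⊆C rC≤rA = +-cancelʳ-≤ (r A) _ _ (begin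
    r (B ∪ C) + r A        ≤⟨ +-monoʳ-≤ _ (r-mono λ x∈A → x∈p∩q⁺ (A⊆B x∈A , A⊆C x∈A)) ⟩
    r (B ∪ C) + r (B ∩ C)  ≤⟨ r-submod B C ⟩
    r B + r C              ≤⟨ +-monoʳ-≤ _ rC≤rA ⟩
    r B + r A              ∎)
    where open ≤-Reasoning

  r-spanned : ∀ X Y → (∀ {e} → e ∈ Y → r (X ∪ ⁅ e ⁆) ≤ r X) → r (X ∪ Y) ≤ r X
  r-spanned X Y = subset-induction (λ Y → r (X ∪ Y) ≤ r X) (r-mono (∪-lub ⊆-refl ⊥⊆))
    (λ {p} {q} rp rq → ≤-trans
      (r-mono (∪-lub (⊆-trans (p⊆p∪q p) (p⊆p∪q (X ∪ q))) (∪-mono (q⊆p∪q X p) (q⊆p∪q X q))))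
      (≤-trans (r-absorb {X} {X ∪ p} {X ∪ q} (p⊆p∪q p) (p⊆p∪q q) rq) rp)) Y

  -- `Z - e` spans `e`, hence so does `X - e`.
  r-delete-⊆ : ∀ {Z X e} → e ∈ Z → Z ⊆ X → r Z ≤ r (Z - e) → r X ≤ r (X - e)
  r-delete-⊆ {Z} {X} {e} e∈Z Z⊆X rZ≤ = ≤-trans
    (r-mono (⊆-trans (p⊆p-x∪⁅x⁆ X e) (∪-mono {p = X - e} ⊆-refl (⁅⁆-⊆ e∈Z))))
    (r-absorb {Z - e} {X - e} {Z}
      (λ x∈ → x∈p∧x≢y⇒x∈p-y (Z⊆X (p─q⊆p Z ⁅ e ⁆ x∈)) (x∈p-y⇒x≢y Z e x∈))
      (p─q⊆p Z ⁅ e ⁆) rZ≤)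

  Independent : Subset n → Set
  Independent I = r I ≡ ∣ I ∣

  independent? : Decidable Independent
  independent? I = r I ℕ.≟ ∣ I ∣

  independent-∅ : Independent ∅
  independent-∅ = ≤-antisym (r≤∣∣ ∅) (≤-trans (≤-reflexive (∣⊥∣≡0 n)) z≤n)

  -- The elements of `I ─ J` raise the rank of `J` by at most their number, so a defect of `J` would
  -- persist in `I`.
  independent-⊆ : ∀ {J I} → J ⊆ I → Independent I → Independent J
  independent-⊆ {J} {I} J⊆I ind = ≤-antisym (r≤∣∣ J) (+-cancelʳ-≤ ∣ I ─ J ∣ _ _ (begin
    ∣ J ∣ + ∣ I ─ J ∣      ≤⟨ +-monoˡ-≤ _ (p⊆q⇒∣p∣≤∣q∣ {q = I ∩ J} λ x∈J → x∈p∩q⁺ (J⊆I x∈J , x∈J)) ⟩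
    ∣ I ∩ J ∣ + ∣ I ─ J ∣  ≡⟨ ∣p∩q∣+∣p─q∣≡∣p∣ I J ⟩
    ∣ I ∣                  ≡⟨ ind ⟨
    r I                    ≤⟨ r-mono split ⟩
    r (J ∪ (I ─ J))        ≤⟨ r-∪-≤ J (I ─ J) ⟩
    r J + ∣ I ─ J ∣        ∎))
    where
    open ≤-Reasoning
    split : I ⊆ J ∪ (I ─ J)
    split {x} x∈I with x ∈? J
    ... | yes x∈J = p⊆p∪q (I ─ J) x∈J
    ... | no x∉J = q⊆p∪q J (I ─ J) (x∈p∧x∉q⇒x∈p─q x∈I x∉J)

  maximal-spans : ∀ {B} X → Independent B → Maximal independent? X B → r X ≤ r B
  maximal-spans {B} X ind maxi = ≤-trans (r-mono (q⊆p∪q B X)) (r-spanned B X noincrease)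
    where
    noincrease : ∀ {e} → e ∈ X → r (B ∪ ⁅ e ⁆) ≤ r B
    noincrease {e} e∈X with e ∈? B
    ... | yes e∈B = r-mono (∪-lub ⊆-refl (⁅⁆-⊆ e∈B))
    ... | no e∉B = ℕ.s≤s⁻¹ (≤-trans (≤∧≢⇒< (r≤∣∣ (B ∪ ⁅ e ⁆)) (maxi e e∈X e∉B))
      (≤-reflexive (trans (∣p∪⁅x⁆∣≡1+∣p∣ B e∉B) (cong suc (sym ind)))))

  basis : ∀ X → ∃[ B ] (B ⊆ X × Independent B × r B ≡ r X)
  basis X =
    let B , _ , B⊆X , ind , maxi = extend independent? X ∅ ⊥⊆ independent-∅
    in B , B⊆X , ind , ≤-antisym (r-mono B⊆X) (maximal-spans X ind maxi)

  independent-augment : ∀ {X Y} → Independent X → Independent Y → ∣ X ∣ < ∣ Y ∣ →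
                        ∃[ e ] (e ∈ Y × e ∉ X × Independent (X ∪ ⁅ e ⁆))
  independent-augment {X} {Y} indX indY lt
    with any? (λ e → (e ∈? Y) ×-dec (¬? (e ∈? X) ×-dec independent? (X ∪ ⁅ e ⁆)))
  ... | yes found = found
  ... | no none = contradiction
    (subst₂ _≤_ indY indX (maximal-spans Y indX (λ e e∈Y e∉X ind → none (e , e∈Y , e∉X , ind)))) (<⇒≱ lt)

  toMatroid : Matroid n
  toMatroid = record
    { Indep   = Independent
    ; indep-∅ = independent-∅
    ; indep-⊆ = λ {X} {Y} → independent-⊆ {X} {Y}
    ; augment = independent-augment
    }

  -- By monotonicity the inequalities here and in `Cyclic` are equalities: a flat contains what it
  -- spans, and a cyclic set has no isthmus.
  Flat : Subset n → Set
  Flat X = ∀ e → r (X ∪ ⁅ e ⁆) ≤ r X → e ∈ X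

  Cyclic : Subset n → Set
  Cyclic X = ∀ e → e ∈ X → r X ≤ r (X - e)

  CyclicFlat : Subset n → Set
  CyclicFlat X = Flat X × Cyclic X

  cl : Subset n → Subset n
  cl X = select (λ e → r (X ∪ ⁅ e ⁆) ≤? r X)

  ⊆-cl : ∀ X → X ⊆ cl X
  ⊆-cl X e∈X = ∈-select⁺ (λ e → r (X ∪ ⁅ e ⁆) ≤? r X) (r-mono (∪-lub ⊆-refl (⁅⁆-⊆ e∈X)))

  r-cl : ∀ X → r (cl X) ≤ r X
  r-cl X = ≤-trans (r-mono (q⊆p∪q X (cl X)))
                   (r-spanned X (cl X) (∈-select⁻ (λ e → r (X ∪ ⁅ e ⁆) ≤? r X)))

  -- An element of `X` is spanned by the rest because `X` is cyclic; removing any other element of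
  -- `cl X` leaves `X` and hence the full rank.
  cl-cyclicFlat : ∀ {X} → Cyclic X → CyclicFlat (cl X)
  cl-cyclicFlat {X} cyc = flat , cyclic
    where
    flat : Flat (cl X)
    flat e le = ∈-select⁺ (λ e → r (X ∪ ⁅ e ⁆) ≤? r X)
      (≤-trans (r-mono (∪-mono {q = ⁅ e ⁆} (⊆-cl X) ⊆-refl)) (≤-trans le (r-cl X)))
    cyclic : Cyclic (cl X)
    cyclic e e∈ with e ∈? X
    ... | yes e∈X = r-delete-⊆ e∈X (⊆-cl X) (cyc e e∈X)
    ... | no e∉X = ≤-trans (r-cl X) (r-mono λ {x} x∈X → x∈p∧x≢y⇒x∈p-y (⊆-cl X x∈X) λ { refl → e∉X x∈X })

  ∪-cyclic : ∀ {X Y} → Cyclic X → Cyclic Y → Cyclic (X ∪ Y)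
  ∪-cyclic {X} {Y} cX cY e e∈ with x∈p∪q⁻ X Y e∈
  ... | inj₁ e∈X = r-delete-⊆ e∈X (p⊆p∪q Y) (cX e e∈X)
  ... | inj₂ e∈Y = r-delete-⊆ e∈Y (q⊆p∪q X Y) (cY e e∈Y)

-- Translation between matroids and rank functions.

open RankFunction using (r; Independent; CyclicFlat; Cyclic)

record Represents (M : Matroid n) (ρ : RankFunction n) : Set where
  field
    indep⇔ : ∀ I → Matroid.Indep M I ⇔ Independent ρ I
open Represents

module _ {M : Matroid n} {ρ : RankFunction n} (rep : Represents M ρ) where
  private
    module ρ = RankFunction ρ
    module M = Matroid M
    to : ∀ {I} → M.Indep I → ρ.Independent I
    to {I} = Equivalence.to (indep⇔ rep I)
    from : ∀ {I} → ρ.Independent I → M.Indep I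
    from {I} = Equivalence.from (indep⇔ rep I)

  isRank : ∀ X → IsRank M X (ρ.r X)
  isRank X =
    let B , B⊆X , ind , eq = ρ.basis X
    in (B , B⊆X , from ind , trans (sym ind) eq)
     , λ I I⊆X indI → ≤-trans (≤-reflexive (sym (to indI))) (ρ.r-mono I⊆X)

  isRank-unique : ∀ {X m} → IsRank M X m → m ≡ ρ.r X
  isRank-unique {X} ((I , I⊆X , indI , refl) , bound) =
    let (B , B⊆X , indB , eqB) , bound′ = isRank X
    in ≤-antisym (bound′ I I⊆X indI) (≤-trans (≤-reflexive (sym eqB)) (bound B B⊆X indB))

  isCyclicFlat⇒cyclicFlat : ∀ {X} → IsCyclicFlat M X → ρ.CyclicFlat X
  isCyclicFlat⇒cyclicFlat {X} (flat , noIsthmus) = flat′ , cyclic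
    where
    flat′ : ρ.Flat X
    flat′ e le = flat e (ρ.r X , isRank X ,
      subst (IsRank M (X ∪ ⁅ e ⁆)) (≤-antisym le (ρ.r-mono (p⊆p∪q ⁅ e ⁆))) (isRank (X ∪ ⁅ e ⁆)))
    cyclic : ρ.Cyclic X
    cyclic e e∈X with ρ.r X ≤? ρ.r (X - e)
    ... | yes le = le
    ... | no r≰ = ⊥-elim (noIsthmus e (e∈X , inBasis))
      where
      inBasis : ∀ B → IsBasisOf M X B → e ∈ B
      inBasis B (B⊆X , indB , maxi) with e ∈? B
      ... | yes e∈B = e∈B
      ... | no e∉B = ⊥-elim (r≰ (≤-trans
        (ρ.maximal-spans X (to indB) λ x x∈X x∉B ind → x∉B
          (maxi (B ∪ ⁅ x ⁆) (p⊆p∪q ⁅ x ⁆) (∪-lub B⊆X (⁅⁆-⊆ x∈X)) (from ind) (q⊆p∪q B ⁅ x ⁆ (x∈⁅x⁆ x))))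
        (ρ.r-mono λ x∈B → x∈p∧x≢y⇒x∈p-y (B⊆X x∈B) λ { refl → e∉B x∈B })))

  cyclicFlat⇒isCyclicFlat : ∀ {X} → ρ.CyclicFlat X → IsCyclicFlat M X
  cyclicFlat⇒isCyclicFlat {X} (flat , cyclic) = flat′ , noIsthmus
    where
    flat′ : IsFlat M X
    flat′ e (m , rX , rXe) = flat e (≤-reflexive (trans (sym (isRank-unique rXe)) (isRank-unique rX)))
    noIsthmus : ∀ e → ¬ IsIsthmusOfRestriction M X e
    noIsthmus e (e∈X , inBasis) =
      -- Deleting `e` keeps the rank, so a basis of `X - e` is a basis of `X` that avoids `e`.
      let B , B⊆ , ind , eq = ρ.basis (X - e)
      in x∈p-y⇒x≢y X e (B⊆ (inBasis B
           ( ⊆-trans B⊆ (p─q⊆p X ⁅ e ⁆)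
           , from ind
           , λ B′ B⊆B′ B′⊆X indB′ → ⊆∧∣∣≤⇒⊇ B B′ B⊆B′
               (≤-trans (≤-reflexive (sym (to indB′))) (≤-trans (ρ.r-mono B′⊆X)
                 (≤-trans (cyclic e e∈X) (≤-reflexive (trans (sym eq) ind)))))))) refl

represents-unique : {M : Matroid n} {ρ ρ′ : RankFunction n} →
  Represents M ρ → Represents M ρ′ → ∀ X → r ρ X ≡ r ρ′ X
represents-unique rep rep′ X = isRank-unique rep′ (isRank rep X)

module _ (M : Matroid n) (Indep? : Decidable (Matroid.Indep M)) where
  open Matroid M

  private
    grow : ∀ X I → I ⊆ X → Indep I → ∃[ B ] (I ⊆ B × B ⊆ X × Indep B × Maximal Indep? X B)
    grow X = extend Indep? X

    maximal-largest : ∀ {X B I} → Indep B → Maximal Indep? X B → I ⊆ X → Indep I → ∣ I ∣ ≤ ∣ B ∣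
    maximal-largest {X} {B} {I} indB maxi I⊆X indI with ∣ I ∣ ≤? ∣ B ∣
    ... | yes le = le
    ... | no I≰B = let e , e∈I , e∉B , ind = augment indB indI (≰⇒> I≰B) in ⊥-elim (maxi e (I⊆X e∈I) e∉B ind)

    base : Subset n → Subset n
    base X = proj₁ (grow X ∅ ⊥⊆ indep-∅)
    base-⊆ : ∀ X → base X ⊆ X
    base-⊆ X = proj₁ (proj₂ (proj₂ (grow X ∅ ⊥⊆ indep-∅)))
    base-indep : ∀ X → Indep (base X)
    base-indep X = proj₁ (proj₂ (proj₂ (proj₂ (grow X ∅ ⊥⊆ indep-∅))))
    base-largest : ∀ X {I} → I ⊆ X → Indep I → ∣ I ∣ ≤ ∣ base X ∣
    base-largest X = maximal-largest (base-indep X) (proj₂ (proj₂ (proj₂ (proj₂ (grow X ∅ ⊥⊆ indep-∅)))))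

    -- A basis of `X ∩ Y` is extended to a basis `B` of `X ∪ Y`; then `B ∩ X` and `B ∩ Y` are
    -- independent, cover `B` and both contain the basis of `X ∩ Y`.
    base-submod : ∀ X Y → ∣ base (X ∪ Y) ∣ + ∣ base (X ∩ Y) ∣ ≤ ∣ base X ∣ + ∣ base Y ∣
    base-submod X Y = begin
      ∣ base (X ∪ Y) ∣ + ∣ base (X ∩ Y) ∣
        ≤⟨ +-mono-≤ (maximal-largest indB maxi (base-⊆ (X ∪ Y)) (base-indep (X ∪ Y))) (p⊆q⇒∣p∣≤∣q∣ inter) ⟩
      ∣ B ∣ + ∣ (B ∩ X) ∩ (B ∩ Y) ∣
        ≤⟨ +-monoˡ-≤ _ (p⊆q⇒∣p∣≤∣q∣ union) ⟩
      ∣ (B ∩ X) ∪ (B ∩ Y) ∣ + ∣ (B ∩ X) ∩ (B ∩ Y) ∣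
        ≡⟨ ∣p∪q∣+∣p∩q∣≡∣p∣+∣q∣ (B ∩ X) (B ∩ Y) ⟩
      ∣ B ∩ X ∣ + ∣ B ∩ Y ∣
        ≤⟨ +-mono-≤ (base-largest X (p∩q⊆q B X) (indep-⊆ (p∩q⊆p B X) indB))
                    (base-largest Y (p∩q⊆q B Y) (indep-⊆ (p∩q⊆p B Y) indB)) ⟩
      ∣ base X ∣ + ∣ base Y ∣ ∎
      where
      open ≤-Reasoning
      grown = grow (X ∪ Y) (base (X ∩ Y))
        (⊆-trans (base-⊆ (X ∩ Y)) (⊆-trans (p∩q⊆p X Y) (p⊆p∪q Y))) (base-indep (X ∩ Y))
      B = proj₁ grown
      ⊆B : base (X ∩ Y) ⊆ B
      ⊆B = proj₁ (proj₂ grown)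
      B⊆ : B ⊆ X ∪ Y
      B⊆ = proj₁ (proj₂ (proj₂ grown))
      indB = proj₁ (proj₂ (proj₂ (proj₂ grown)))
      maxi = proj₂ (proj₂ (proj₂ (proj₂ grown)))
      inter : base (X ∩ Y) ⊆ (B ∩ X) ∩ (B ∩ Y)
      inter x∈ = let x∈X , x∈Y = x∈p∩q⁻ X Y (base-⊆ (X ∩ Y) x∈)
                 in x∈p∩q⁺ (x∈p∩q⁺ (⊆B x∈ , x∈X) , x∈p∩q⁺ (⊆B x∈ , x∈Y))
      union : B ⊆ (B ∩ X) ∪ (B ∩ Y)
      union x∈ with x∈p∪q⁻ X Y (B⊆ x∈)
      ... | inj₁ x∈X = p⊆p∪q (B ∩ Y) (x∈p∩q⁺ (x∈ , x∈X))
      ... | inj₂ x∈Y = q⊆p∪q (B ∩ X) (B ∩ Y) (x∈p∩q⁺ (x∈ , x∈Y))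

  rankFunction : RankFunction n
  rankFunction = record
    { r        = λ X → ∣ base X ∣
    ; r≤∣∣     = λ X → p⊆q⇒∣p∣≤∣q∣ (base-⊆ X)
    ; r-mono   = λ {X} {Y} X⊆Y → base-largest Y (⊆-trans (base-⊆ X) X⊆Y) (base-indep X)
    ; r-submod = base-submod
    }

  rankFunction-represents : Represents M rankFunction
  indep⇔ rankFunction-represents I = mk⇔
    (λ ind → ≤-antisym (p⊆q⇒∣p∣≤∣q∣ (base-⊆ I)) (base-largest I ⊆-refl ind))
    (λ eq → indep-⊆ (⊆∧∣∣≤⇒⊇ (base I) I (base-⊆ I) (≤-reflexive (sym eq))) (base-indep I))

-- Contraction and its cyclic flats.

module _ (ρ : RankFunction n) (Z : Subset n) where
  private
    module ρ = RankFunction ρ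

    rZ≤ : ∀ X → ρ.r Z ≤ ρ.r (X ∪ Z)
    rZ≤ X = ρ.r-mono (q⊆p∪q X Z)

  -- The rank function of the contraction by `Z`, kept on the whole ground set, so that elements of
  -- `Z` become loops.
  r/ : Subset n → ℕ
  r/ X = ρ.r (X ∪ Z) ∸ ρ.r Z

  r/+r : ∀ X → r/ X + ρ.r Z ≡ ρ.r (X ∪ Z)
  r/+r X = m∸n+n≡m (rZ≤ X)

  contraction : RankFunction n
  contraction = record
    { r        = r/
    ; r≤∣∣     = λ X → ≤-trans (∸-monoˡ-≤ (ρ.r Z) (≤-trans (ρ.r-mono (∪-comm-⊆ X)) (ρ.r-∪-≤ Z X)))
                               (≤-reflexive (m+n∸m≡n (ρ.r Z) ∣ X ∣))
    ; r-mono   = λ X⊆Y → ∸-monoˡ-≤ (ρ.r Z) (ρ.r-mono (∪-mono {q = Z} X⊆Y ⊆-refl))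
    ; r-submod = submod
    }
    where
    open ≤-Reasoning
    ∪-comm-⊆ : ∀ X → X ∪ Z ⊆ Z ∪ X
    ∪-comm-⊆ X = ∪-lub (q⊆p∪q Z X) (p⊆p∪q X)
    regroup : ∀ X Y → (r/ X + r/ Y) + (ρ.r Z + ρ.r Z) ≡ ρ.r (X ∪ Z) + ρ.r (Y ∪ Z)
    regroup X Y = trans (+-interchange (r/ X) (r/ Y) (ρ.r Z) (ρ.r Z)) (cong₂ _+_ (r/+r X) (r/+r Y))
    submod : ∀ X Y → r/ (X ∪ Y) + r/ (X ∩ Y) ≤ r/ X + r/ Y
    -- Adding `ρ.r Z` twice on both sides undoes the truncated subtractions.
    submod X Y = +-cancelʳ-≤ (ρ.r Z + ρ.r Z) _ _ (begin
      r/ (X ∪ Y) + r/ (X ∩ Y) + (ρ.r Z + ρ.r Z)            ≡⟨ regroup (X ∪ Y) (X ∩ Y) ⟩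
      ρ.r ((X ∪ Y) ∪ Z) + ρ.r ((X ∩ Y) ∪ Z)                ≤⟨ +-mono-≤ (ρ.r-mono union) (ρ.r-mono inter) ⟩
      ρ.r ((X ∪ Z) ∪ (Y ∪ Z)) + ρ.r ((X ∪ Z) ∩ (Y ∪ Z))    ≤⟨ ρ.r-submod (X ∪ Z) (Y ∪ Z) ⟩
      ρ.r (X ∪ Z) + ρ.r (Y ∪ Z)                            ≡⟨ regroup X Y ⟨
      r/ X + r/ Y + (ρ.r Z + ρ.r Z)                        ∎)
      where
      union : (X ∪ Y) ∪ Z ⊆ (X ∪ Z) ∪ (Y ∪ Z)
      union = ∪-lub (∪-mono {p = X} (p⊆p∪q Z) (p⊆p∪q Z)) (⊆-trans (q⊆p∪q X Z) (p⊆p∪q (Y ∪ Z)))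
      inter : (X ∩ Y) ∪ Z ⊆ (X ∪ Z) ∩ (Y ∪ Z)
      inter x∈ = x∈p∩q⁺ (∪-mono {q = Z} (p∩q⊆p X Y) ⊆-refl x∈ , ∪-mono {q = Z} (p∩q⊆q X Y) ⊆-refl x∈)

  r/-≤⇒r-≤ : ∀ {X Y} → r/ X ≤ r/ Y → ρ.r (X ∪ Z) ≤ ρ.r (Y ∪ Z)
  r/-≤⇒r-≤ {X} {Y} le = subst₂ _≤_ (r/+r X) (r/+r Y) (+-monoˡ-≤ (ρ.r Z) le)

  private
    ∪Z⊆ : ∀ {X Y} → X ⊆ Y → Z ⊆ Y → ρ.r (X ∪ Z) ≤ ρ.r Y
    ∪Z⊆ X⊆Y Z⊆Y = ρ.r-mono (∪-lub X⊆Y Z⊆Y)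

    ⊆∪Z : ∀ X → ρ.r X ≤ ρ.r (X ∪ Z)
    ⊆∪Z X = ρ.r-mono (p⊆p∪q Z)

  -- Elements of `Z` are loops of the contraction, so its flats contain `Z`. In `X` they are no
  -- isthmuses because `Z` is cyclic; for the other elements this is read off from the contraction.
  cyclicFlat/⇒ : ∀ {X} → ρ.Cyclic Z → CyclicFlat contraction X → Z ⊆ X × ρ.CyclicFlat X
  cyclicFlat/⇒ {X} cycZ (flat , cyclic) = Z⊆X , flat′ , cyclic′
    where
    Z⊆X : Z ⊆ X
    Z⊆X {e} e∈Z = flat e (∸-monoˡ-≤ (ρ.r Z) (ρ.r-mono (∪-lub (∪-mono {p = X} ⊆-refl (⁅⁆-⊆ e∈Z)) (q⊆p∪q X Z))))
    flat′ : ρ.Flat X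
    flat′ e le = flat e (∸-monoˡ-≤ (ρ.r Z) (≤-trans (∪Z⊆ ⊆-refl (⊆-trans Z⊆X (p⊆p∪q ⁅ e ⁆))) (≤-trans le (⊆∪Z X))))
    cyclic′ : ρ.Cyclic X
    cyclic′ e e∈X with e ∈? Z
    ... | yes e∈Z = ρ.r-delete-⊆ e∈Z Z⊆X (cycZ e e∈Z)
    ... | no e∉Z = ≤-trans (⊆∪Z X) (≤-trans (r/-≤⇒r-≤ (cyclic e e∈X))
                     (∪Z⊆ ⊆-refl λ {x} x∈Z → x∈p∧x≢y⇒x∈p-y (Z⊆X x∈Z) λ { refl → e∉Z x∈Z }))

  cyclicFlat/⇐ : ∀ {X} → Z ⊆ X → ρ.CyclicFlat X → CyclicFlat contraction X
  cyclicFlat/⇐ {X} Z⊆X (flat , cyclic) =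
    (λ e le → flat e (≤-trans (⊆∪Z (X ∪ ⁅ e ⁆)) (≤-trans (r/-≤⇒r-≤ le) (∪Z⊆ ⊆-refl Z⊆X)))) ,
    (λ e e∈X → ∸-monoˡ-≤ (ρ.r Z) (≤-trans (∪Z⊆ ⊆-refl Z⊆X) (≤-trans (cyclic e e∈X) (⊆∪Z (X - e)))))

-- Presentations of transversal matroids

Presents : (Fin n → Subset k) → RankFunction n → Set
Presents Γ ρ = ∀ I → Independent ρ I ⇔ ∃ (Matching Γ I)

dual : (Fin k → Subset n) → Fin n → Subset k
dual A e = select (λ i → e ∈? A i)

∈-dual⁺ : (A : Fin k → Subset n) {e : Fin n} {i : Fin k} → e ∈ A i → i ∈ dual A e
∈-dual⁺ A {e} = ∈-select⁺ (λ i → e ∈? A i)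

∈-dual⁻ : (A : Fin k → Subset n) {e : Fin n} {i : Fin k} → i ∈ dual A e → e ∈ A i
∈-dual⁻ A {e} = ∈-select⁻ (λ i → e ∈? A i)

presents⇒transversal : {M : Matroid n} {ρ : RankFunction n} (Γ : Fin n → Subset k) →
                       Represents M ρ → Presents Γ ρ → IsTransversal M
presents⇒transversal {k = k} Γ rep pres = k , dual Γ , λ I → mk⇔
  (λ ind → let φ , into , inj = Equivalence.to (pres I) (Equivalence.to (indep⇔ rep I) ind)
           in φ , (λ e e∈I → ∈-dual⁺ Γ (into e e∈I)) , inj)
  (λ (φ , into , inj) → Equivalence.from (indep⇔ rep I)
    (Equivalence.from (pres I) (φ , (λ e e∈I → ∈-dual⁻ Γ (into e e∈I)) , inj)))

transversal⇒presents : (ρ : RankFunction n) → IsTransversal (RankFunction.toMatroid ρ) →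
                       ∃[ k ] Σ (Fin n → Subset k) λ Γ → Presents Γ ρ
transversal⇒presents ρ (k , A , pt) = k , dual A , λ I → mk⇔
  (λ ind → let φ , into , inj = Equivalence.to (pt I) ind
           in φ , (λ e e∈I → ∈-dual⁺ A (into e e∈I)) , inj)
  (λ (φ , into , inj) → Equivalence.from (pt I) (φ , (λ e e∈I → ∈-dual⁻ A (into e e∈I)) , inj))

module _ {Γ : Fin n → Subset k} {ρ : RankFunction n} (pres : Presents Γ ρ) where
  private
    module ρ = RankFunction ρ

  r≤∣nbhd∣ : ∀ Y → ρ.r Y ≤ ∣ nbhd Γ Y ∣
  r≤∣nbhd∣ Y =
    let B , B⊆Y , ind , eq = ρ.basis Y
        φ , matching = Equivalence.to (pres B) ind
    in ≤-trans (≤-reflexive (trans (sym eq) ind))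
         (≤-trans (matching⇒∣∣≤ Γ B φ matching B ⊆-refl) (p⊆q⇒∣p∣≤∣q∣ (nbhd-mono Γ {B} B⊆Y)))

  -- Hall's theorem with d dummy partners available to every element.
  deficiency : ∀ X d → Fin k → (∀ Y → Y ⊆ X → Nonempty Y → ∣ Y ∣ ≤ ∣ nbhd Γ Y ∣ + d) → ∣ X ∣ ≤ ρ.r X + d
  deficiency X d i₀ cond = begin
    ∣ X ∣                  ≡⟨ ∣p∩q∣+∣p─q∣≡∣p∣ X I ⟨
    ∣ X ∩ I ∣ + ∣ X ─ I ∣  ≤⟨ +-mono-≤ (∣p∩q∣≤∣q∣ X I) dummies ⟩
    ∣ I ∣ + d              ≡⟨ cong (_+ d) (Equivalence.from (pres I) (ψ , ψ-into , ψ-inj)) ⟨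
    ρ.r I + d              ≤⟨ +-monoˡ-≤ d (ρ.r-mono I⊆X) ⟩
    ρ.r X + d              ∎
    where
    open ≤-Reasoning
    Γᵈ : Fin n → Subset (k + d)
    Γᵈ e = Γ e ++ full
    hallᵈ : HallCondition Γᵈ X
    hallᵈ Y Y⊆X with nonempty? Y
    ... | no empty = ≤-trans (≤-reflexive (trans (cong ∣_∣ (Empty-unique empty)) (∣⊥∣≡0 n))) z≤n
    ... | yes (e , e∈Y) = begin
      ∣ Y ∣                                          ≤⟨ cond Y Y⊆X (e , e∈Y) ⟩
      ∣ nbhd Γ Y ∣ + d                               ≡⟨ cong (∣ nbhd Γ Y ∣ +_) (∣⊤∣≡n d) ⟨
      ∣ nbhd Γ Y ∣ + ∣ full {d} ∣                    ≤⟨ +-monoʳ-≤ ∣ nbhd Γ Y ∣ (p⊆q⇒∣p∣≤∣q∣ {p = full} (∈-nbhd⁺ (const full) e∈Y)) ⟩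
      ∣ nbhd Γ Y ∣ + ∣ nbhd (const (full {d})) Y ∣   ≡⟨ ∣nbhd-++∣ Γ (const full) Y ⟨
      ∣ nbhd Γᵈ Y ∣                                  ∎
    matching = hall Γᵈ X (const (i₀ ↑ˡ d)) hallᵈ
    φ = proj₁ matching
    φ-into = proj₁ (proj₂ matching)
    φ-inj = proj₂ (proj₂ matching)
    -- The elements of `X` with a genuine partner form an independent set `I`; the others go
    -- injectively to the `d` dummies. Where `φ` picks a dummy, `ψ` takes the default `i₀`.
    Proper : Fin n → Set
    Proper e = e ∈ X × ∃[ i ] φ e ≡ i ↑ˡ d
    proper? : Decidable Proper
    proper? e = (e ∈? X) ×-dec any? (λ i → φ e ≟ i ↑ˡ d)
    I = select proper?
    I⊆X : I ⊆ X
    I⊆X e∈I = proj₁ (∈-select⁻ proper? e∈I)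
    ψ : Fin n → Fin k
    ψ e = [ id , const i₀ ]′ (splitAt k (φ e))
    ψ-spec : ∀ {e} → e ∈ I → φ e ≡ ψ e ↑ˡ d
    ψ-spec e∈I = let i , eq = proj₂ (∈-select⁻ proper? e∈I)
      in trans eq (cong (_↑ˡ d) (sym (trans
            (cong ([ id , const i₀ ]′ ∘ splitAt k) eq)
            (cong [ id , const i₀ ]′ (splitAt-↑ˡ k i d)))))
    ψ-into : ∀ e → e ∈ I → ψ e ∈ Γ e
    ψ-into e e∈I = lookup⇒[]= (ψ e) (Γ e) (trans (sym (lookup-++ˡ (Γ e) full (ψ e)))
      ([]=⇒lookup (subst (_∈ Γᵈ e) (ψ-spec e∈I) (φ-into e (I⊆X e∈I)))))
    ψ-inj : ∀ e f → e ∈ I → f ∈ I → ψ e ≡ ψ f → e ≡ f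
    ψ-inj e f e∈I f∈I eq = φ-inj e f (I⊆X e∈I) (I⊆X f∈I)
      (trans (ψ-spec e∈I) (trans (cong (_↑ˡ d) eq) (sym (ψ-spec f∈I))))
    dummy : ∀ e → e ∈ X ─ I → φ e ∈ ∅ {k} ++ full {d}
    dummy e e∈ with splitAt k (φ e) in eq
    ... | inj₁ i = ⊥-elim (x∈p─q⇒x∉q X I e∈ (∈-select⁺ proper? (p─q⊆p X I e∈ , i , sym (splitAt⁻¹-↑ˡ eq))))
    ... | inj₂ j = subst (_∈ ∅ {k} ++ full {d}) (splitAt⁻¹-↑ʳ eq)
      (lookup⇒[]= (k ↑ʳ j) _ (trans (lookup-++ʳ (∅ {k}) full j) ([]=⇒lookup (∈⊤ {x = j}))))
    dummies : ∣ X ─ I ∣ ≤ d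
    dummies = ≤-trans
      (∣∣-injection φ (X ─ I) (∅ {k} ++ full {d}) dummy
        (λ e f e∈ f∈ → φ-inj e f (p─q⊆p X I e∈) (p─q⊆p X I f∈)))
      (≤-reflexive (trans (∣p++q∣≡∣p∣+∣q∣ (∅ {k}) full) (cong₂ _+_ (∣⊥∣≡0 k) (∣⊤∣≡n d))))

  -- The set Y found below attains König's formula r X = min (|Γ(Y)| + |X - Y|), and an element of
  -- X outside Y would be an isthmus of X.
  cyclic⇒∣nbhd∣≤r′ : ∀ {X} → Fin k → ρ.Cyclic X → ∣ nbhd Γ X ∣ ≤ ρ.r X
  cyclic⇒∣nbhd∣≤r′ {X} i₀ cyc with ∣ X ∣ ≤? ρ.r X
  ... | yes X≤r = ≤-trans (p⊆q⇒∣p∣≤∣q∣ {q = ∅} (nbhd-⊆ Γ X λ e∈X → ⊥-elim (absurd e∈X)))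
      (≤-trans (≤-reflexive (∣⊥∣≡0 k)) z≤n)
    where
    absurd : ∀ {e} → e ∈ X → ⊥
    absurd {e} e∈X = <⇒≱ (x∈p⇒∣p-x∣<∣p∣ e∈X) (≤-trans X≤r (≤-trans (cyc e e∈X) (ρ.r≤∣∣ (X - e))))
  ... | no X≰r = search (anySubset? (λ Y → (Y ⊆? X) ×-dec (∣ nbhd Γ Y ∣ + d <? ∣ Y ∣)))
    where
    open ≤-Reasoning
    -- One less than the nullity of `X`: with this many dummies the conclusion of `deficiency` just
    -- fails, so some `Y` violates its condition.
    d = ∣ X ∣ ∸ suc (ρ.r X)
    ∣X∣≡ : ∣ X ∣ ≡ ρ.r X + suc d
    ∣X∣≡ = trans (sym (m+[n∸m]≡n (≰⇒> X≰r))) (sym (+-suc (ρ.r X) d))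
    tight : ∀ Y → Y ⊆ X → ∣ nbhd Γ Y ∣ + d < ∣ Y ∣ → ∣ nbhd Γ Y ∣ + ∣ X ─ Y ∣ ≤ ρ.r X
    tight Y Y⊆X lt = +-cancelʳ-≤ (suc d) _ _ (begin
      ∣ nbhd Γ Y ∣ + ∣ X ─ Y ∣ + suc d     ≡⟨ xy∙z≈xz∙y ∣ nbhd Γ Y ∣ ∣ X ─ Y ∣ (suc d) ⟩
      ∣ nbhd Γ Y ∣ + suc d + ∣ X ─ Y ∣     ≡⟨ cong (_+ ∣ X ─ Y ∣) (+-suc ∣ nbhd Γ Y ∣ d) ⟩
      suc (∣ nbhd Γ Y ∣ + d) + ∣ X ─ Y ∣
        ≤⟨ +-monoˡ-≤ ∣ X ─ Y ∣ (≤-trans lt (p⊆q⇒∣p∣≤∣q∣ {q = X ∩ Y} λ e∈Y → x∈p∩q⁺ (Y⊆X e∈Y , e∈Y))) ⟩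
      ∣ X ∩ Y ∣ + ∣ X ─ Y ∣                ≡⟨ ∣p∩q∣+∣p─q∣≡∣p∣ X Y ⟩
      ∣ X ∣                                ≡⟨ ∣X∣≡ ⟩
      ρ.r X + suc d                        ∎)
    cover : ∀ Y e → X - e ⊆ Y ∪ ((X ─ Y) - e)
    cover Y e {x} x∈ with x ∈? Y
    ... | yes x∈Y = p⊆p∪q _ x∈Y
    ... | no x∉Y = q⊆p∪q Y _ (x∈p∧x≢y⇒x∈p-y (x∈p∧x∉q⇒x∈p─q (p─q⊆p X ⁅ e ⁆ x∈) x∉Y) (x∈p-y⇒x≢y X e x∈))
    search : Dec (∃[ Y ] (Y ⊆ X × ∣ nbhd Γ Y ∣ + d < ∣ Y ∣)) → ∣ nbhd Γ X ∣ ≤ ρ.r X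
    search (no none) = contradiction
      (deficiency X d i₀ λ Y Y⊆X _ → ≮⇒≥ λ lt → none (Y , (λ {_} → Y⊆X) , lt))
      (<⇒≱ (≤-reflexive (trans (sym (+-suc (ρ.r X) d)) (sym ∣X∣≡))))
    search (yes (Y , Y⊆X , lt)) with X ⊆? Y
    ... | yes X⊆Y = ≤-trans (p⊆q⇒∣p∣≤∣q∣ (nbhd-mono Γ X⊆Y)) (≤-trans (m≤m+n _ _) (tight Y Y⊆X lt))
    ... | no X⊈Y =
      let e , e∈X , e∉Y = ⊈⇒∃ X Y X⊈Y
          e∈X─Y = x∈p∧x∉q⇒x∈p─q e∈X e∉Y
      in contradiction (begin-strict
        ρ.r X                                    ≤⟨ cyc e e∈X ⟩
        ρ.r (X - e)                              ≤⟨ ρ.r-mono (cover Y e) ⟩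
        ρ.r (Y ∪ ((X ─ Y) - e))                  ≤⟨ ρ.r-∪-≤ Y ((X ─ Y) - e) ⟩
        ρ.r Y + ∣ (X ─ Y) - e ∣                  <⟨ +-mono-≤-< (r≤∣nbhd∣ Y) (x∈p⇒∣p-x∣<∣p∣ e∈X─Y) ⟩
        ∣ nbhd Γ Y ∣ + ∣ X ─ Y ∣                 ≤⟨ tight Y Y⊆X lt ⟩
        ρ.r X                                    ∎) (<-irrefl refl)

  cyclic⇒∣nbhd∣≤r : ∀ {X} → ρ.Cyclic X → ∣ nbhd Γ X ∣ ≤ ρ.r X
  cyclic⇒∣nbhd∣≤r {X} cyc with nonempty? (nbhd Γ X)
  ... | yes (i , _) = cyclic⇒∣nbhd∣≤r′ i cyc
  ... | no empty = ≤-trans (≤-reflexive (trans (cong ∣_∣ (Empty-unique empty)) (∣⊥∣≡0 k))) z≤n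

-- Decidability of independence

-- Double negation commutes with a quantifier over a finite type; the induction splits subsets by
-- whether they contain `zero`.
¬¬-∀-Subset : {P : Subset n → Set} → (∀ I → ¬ ¬ P I) → ¬ ¬ (∀ I → P I)
¬¬-∀-Subset {zero}  h c = h [] λ p → c λ { [] → p }
¬¬-∀-Subset {suc n} h c = ¬¬-∀-Subset (h ∘ (outside ∷_)) λ p → ¬¬-∀-Subset (h ∘ (inside ∷_)) λ q →
  c λ { (false ∷ I) → p I ; (true ∷ I) → q I }

-- The free matroid, whose only cyclic flat is empty; it serves for lattices with a single element.
free : (n : ℕ) → RankFunction n
free n = record
  { r        = ∣_∣
  ; r≤∣∣     = λ _ → ≤-refl
  ; r-mono   = p⊆q⇒∣p∣≤∣q∣
  ; r-submod = λ X Y → ≤-reflexive (∣p∪q∣+∣p∩q∣≡∣p∣+∣q∣ X Y)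
  }

free-∅-cyclicFlat : ∀ n → CyclicFlat (free n) ∅
free-∅-cyclicFlat n =
  (λ e le → contradiction le (<⇒≱ (≤-reflexive (sym (∣p∪⁅x⁆∣≡1+∣p∣ (∅ {n}) {e} ∉⊥))))) , λ e e∈ → ⊥-elim (∉⊥ e∈)

free-cyclic⇒∅ : ∀ {n X} → Cyclic (free n) X → ∅ ≡ X
free-cyclic⇒∅ cyc = sym (Empty-unique λ (e , e∈X) → <⇒≱ (x∈p⇒∣p-x∣<∣p∣ e∈X) (cyc e e∈X))

module LatticeProperties (L : FinLattice) where
  open FinLattice L public
  open IsBoundedLattice isBoundedLattice public using (antisym; minimum; maximum)
    renaming (refl to ≤L-refl; trans to ≤L-trans)

  _≟L_ : DecidableEquality Carrier
  _≟L_ = via-injection (↔⇒↣ finite) _≟_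

  anyL? : {P : Carrier → Set} → Decidable P → Dec (∃ P)
  anyL? {P} P? = map′ (λ (i , p) → Inverse.from finite i , p)
    (λ (x , p) → Inverse.to finite x , subst P (sym (Inverse.strictlyInverseʳ finite x)) p)
    (any? (P? ∘ Inverse.from finite))

-- A Tr-lattice turns ¬¬P into P, because transversal matroids have decidable independence:
-- the nonempty independent sets of the matroid below exist only in the presence of P, while
-- having its cyclic flats given by f is a negative statement, provable from ¬¬P.
module _ (L : FinLattice) (tr : IsTrLattice L) where
  open LatticeProperties L

  tr-stable : {P : Set} → ¬ ¬ P → (K : P → RankFunction n) → (∀ p q X → r (K p) X ≡ r (K q) X) →
    (f : Carrier → Subset n) → (∀ a b → (a ≤L b) ⇔ (f a ⊆ f b)) →
    (∀ p a → CyclicFlat (K p) (f a)) → (∀ p X → CyclicFlat (K p) X → ∃[ a ] f a ≡ X) →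
    (∀ p → ∃[ e ] Independent (K p) ⁅ e ⁆) → P
  tr-stable {n} {P} ¬¬P K agree f ord cf surj nonloop = conclude (any? λ e → any? λ i → e ∈? A i)
    where
    -- Given `p : P` these are exactly the independent sets of `K p`; without a proof of `P` only
    -- the empty set is certified.
    Indepᴾ : Subset n → Set
    Indepᴾ I = I ≡ ∅ ⊎ Σ P λ p → Independent (K p) I

    indepᴾ⇒ : ∀ p {I} → Indepᴾ I → Independent (K p) I
    indepᴾ⇒ p (inj₁ refl) = RankFunction.independent-∅ (K p)
    indepᴾ⇒ p {I} (inj₂ (q , ind)) = trans (agree p q I) ind

    indepᴾ-⊆ : ∀ {X Y} → X ⊆ Y → Indepᴾ Y → Indepᴾ X
    indepᴾ-⊆ X⊆Y (inj₁ refl) = inj₁ (⊆-antisym X⊆Y ⊥⊆)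
    indepᴾ-⊆ X⊆Y (inj₂ (p , ind)) = inj₂ (p , RankFunction.independent-⊆ (K p) X⊆Y ind)

    augmentᴾ : ∀ {X Y} → Indepᴾ X → Indepᴾ Y → ∣ X ∣ < ∣ Y ∣ → ∃[ e ] (e ∈ Y × e ∉ X × Indepᴾ (X ∪ ⁅ e ⁆))
    augmentᴾ indX (inj₁ refl) lt = contradiction lt (≤⇒≯ (≤-trans (≤-reflexive (∣⊥∣≡0 n)) z≤n))
    augmentᴾ indX (inj₂ (p , indY)) lt =
      let e , e∈Y , e∉X , ind = RankFunction.independent-augment (K p) (indepᴾ⇒ p indX) indY lt
      in e , e∈Y , e∉X , inj₂ (p , ind)

    N : Matroid n
    N = record { Indep = Indepᴾ ; indep-∅ = inj₁ refl ; indep-⊆ = indepᴾ-⊆ ; augment = augmentᴾ }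

    rep : ∀ p → Represents N (K p)
    indep⇔ (rep p) I = mk⇔ (indepᴾ⇒ p) (λ ind → inj₂ (p , ind))

    zIso : ZIsoTo N Carrier _≤L_
    zIso = f
      -- Membership in `f a` is decidable and lack of isthmuses is a negation, so a proof of `P` may
      -- be assumed.
      , (λ a → (λ e inCl → decidable-stable (e ∈? f a) λ e∉ → ¬¬P λ p →
                  e∉ (proj₁ (cyclicFlat⇒isCyclicFlat (rep p) (cf p a)) e inCl))
             , (λ e isth → ¬¬P λ p → proj₂ (cyclicFlat⇒isCyclicFlat (rep p) (cf p a)) e isth))
      , (λ X cfX → decidable-stable (anyL? λ a → ≡-dec Bool._≟_ (f a) X) λ none → ¬¬P λ p →
           none (surj p X (isCyclicFlat⇒cyclicFlat (rep p) cfX)))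
      , (λ a b eq → antisym (Equivalence.from (ord a b) (⊆-reflexive eq))
                            (Equivalence.from (ord b a) (⊆-reflexive (sym eq))))
      , ord

    transversal = tr n N zIso
    A = proj₁ (proj₂ transversal)
    pt = proj₂ (proj₂ transversal)

    -- An element `e` of some member makes `⁅ e ⁆` a partial transversal, hence independent; as it
    -- is nonempty, its certificate contains a proof of `P`. If all members are empty, no nonempty
    -- set is independent, against `nonloop`.
    conclude : Dec (∃[ e ] ∃[ i ] e ∈ A i) → P
    conclude (yes (e , i , e∈A)) = [ (λ eq → ⊥-elim (∉⊥ (subst (e ∈_) eq (x∈⁅x⁆ e)))) , proj₁ ]′
      (Equivalence.from (pt ⁅ e ⁆) ( const i
        , (λ x x∈ → subst (_∈ A i) (sym (x∈⁅y⁆⇒x≡y e x∈)) e∈A)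
        , (λ x y x∈ y∈ _ → trans (x∈⁅y⁆⇒x≡y e x∈) (sym (x∈⁅y⁆⇒x≡y e y∈)))))
    conclude (no none) = ⊥-elim (¬¬P λ p →
      let e , ind = nonloop p
          φ , into , _ = Equivalence.to (pt ⁅ e ⁆) (inj₂ (p , ind))
      in none (e , φ e , into e (x∈⁅x⁆ e)))

-- The interval of cyclic flats above the image of a bottom element.

record UpperPart (L : FinLattice) (M : Matroid n) : Set where
  open FinLattice L
  field
    g      : Carrier → Subset n
    g-ord  : ∀ a b → (a ≤L b) ⇔ (g a ⊆ g b)
    g-cf   : ∀ a → IsCyclicFlat M (g a)
    g-onto : ∀ X → IsCyclicFlat M X → g bot ⊆ X → ∃[ a ] g a ≡ X

module _ {L : FinLattice} {M : Matroid n} (up : UpperPart L M) where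
  open LatticeProperties L
  open UpperPart up

  module _ {ρ : RankFunction n} (rep : Represents M ρ) where

    ρ/bot : RankFunction n
    ρ/bot = contraction ρ (g bot)

    g-cyclicFlat/ : ∀ a → CyclicFlat ρ/bot (g a)
    g-cyclicFlat/ a = cyclicFlat/⇐ ρ (g bot) (Equivalence.to (g-ord bot a) (minimum a))
      (isCyclicFlat⇒cyclicFlat rep (g-cf a))

    g-onto/ : ∀ X → CyclicFlat ρ/bot X → ∃[ a ] g a ≡ X
    g-onto/ X cf =
      let bot⊆X , cfX = cyclicFlat/⇒ ρ (g bot) (proj₂ (isCyclicFlat⇒cyclicFlat rep (g-cf bot))) cf
      in g-onto X (cyclicFlat⇒isCyclicFlat rep cfX) bot⊆X

    g-nonloop/ : ¬ (top ≤L bot) → ∃[ e ] Independent ρ/bot ⁅ e ⁆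
    g-nonloop/ top≰bot =
      let e , _ , e∉ = ⊈⇒∃ (g top) (g bot) (λ sub → top≰bot (Equivalence.from (g-ord top bot) sub))
          lt = ≰⇒> λ le → e∉ (proj₁ (isCyclicFlat⇒cyclicFlat rep (g-cf bot)) e
                 (≤-trans (RankFunction.r-mono ρ (∪-lub (q⊆p∪q ⁅ e ⁆ (g bot)) (p⊆p∪q (g bot)))) le))
      in e , ≤-antisym (RankFunction.r≤∣∣ ρ/bot ⁅ e ⁆) (≤-trans (≤-reflexive (∣⁅x⁆∣≡1 e)) (m<n⇒0<n∸m lt))

    -- A presentation of the contraction by `g bot` has at most rank many neighbours on cyclic flats
    -- and at least rank many on every set. Moving `r ρ (g bot)` across avoids subtraction.
    upperPart-nbhds : IsTrLattice L → ∃[ k ] Σ (Fin n → Subset k) λ Γ →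
      (∀ a → ∣ nbhd Γ (g a) ∣ + r ρ (g bot) ≤ r ρ (g a)) ×
      (∀ J → r ρ (J ∪ g bot) ≤ ∣ nbhd Γ J ∣ + r ρ (g bot))
    upperPart-nbhds tr =
      let k , Γ , pres = transversal⇒presents ρ/bot (tr n (RankFunction.toMatroid ρ/bot) zIso)
      in k , Γ
       , (λ a → ≤-trans (+-monoˡ-≤ (r ρ (g bot)) (cyclic⇒∣nbhd∣≤r {Γ = Γ} {ρ/bot} pres (proj₂ (g-cyclicFlat/ a))))
                  (≤-trans (≤-reflexive (r/+r ρ (g bot) (g a)))
                    (RankFunction.r-mono ρ (∪-lub ⊆-refl (Equivalence.to (g-ord bot a) (minimum a))))))
       , (λ J → ≤-trans (≤-reflexive (sym (r/+r ρ (g bot) J)))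
                  (+-monoˡ-≤ (r ρ (g bot)) (r≤∣nbhd∣ {Γ = Γ} {ρ/bot} pres J)))
      where
      self : Represents (RankFunction.toMatroid ρ/bot) ρ/bot
      indep⇔ self I = mk⇔ id id
      zIso : ZIsoTo (RankFunction.toMatroid ρ/bot) Carrier _≤L_
      zIso = g
        , (λ a → cyclicFlat⇒isCyclicFlat self (g-cyclicFlat/ a))
        , (λ X cf → g-onto/ X (isCyclicFlat⇒cyclicFlat self cf))
        , (λ a b eq → antisym (Equivalence.from (g-ord a b) (⊆-reflexive eq))
                            (Equivalence.from (g-ord b a) (⊆-reflexive (sym eq))))
        , g-ord

  -- `tr-stable` is applied to decidability itself, whose double negation holds because there are
  -- finitely many subsets. If `top` and `bot` differ, the contraction by `g bot` has a nonloop and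
  -- serves as `K`; otherwise it may have none, and a free one-element matroid replaces it.
  tr⇒indep? : IsTrLattice L → Decidable (Matroid.Indep M)
  tr⇒indep? tr with top ≟L bot
  ... | yes top≡bot = tr-stable L tr ¬¬dec (const (free 1)) (λ _ _ _ → refl) (const ∅)
          (λ a b → mk⇔ (λ _ {_} e∈ → e∈) (λ _ → ≤L-trans (maximum a) (subst (_≤L b) (sym top≡bot) (minimum b))))
          (λ _ _ → free-∅-cyclicFlat 1) (λ _ X cf → bot , free-cyclic⇒∅ (proj₂ cf)) (λ _ → zero , refl)
    where
    ¬¬dec : ¬ ¬ (∀ I → Dec (Matroid.Indep M I))
    ¬¬dec = ¬¬-∀-Subset λ I → ¬¬-excluded-middle
  ... | no top≢bot = tr-stable L tr (¬¬-∀-Subset λ I → ¬¬-excluded-middle)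
          (λ dec → ρ/bot (rep dec))
          (λ p q X → cong₂ _∸_ (represents-unique (rep p) (rep q) (X ∪ g bot))
                               (represents-unique (rep p) (rep q) (g bot)))
          g g-ord (λ dec → g-cyclicFlat/ (rep dec)) (λ dec → g-onto/ (rep dec))
          (λ dec → g-nonloop/ (rep dec) λ top≤bot → top≢bot (antisym top≤bot (minimum top)))
    where
    rep : (dec : Decidable (Matroid.Indep M)) → Represents M (rankFunction M dec)
    rep dec = rankFunction-represents M dec

-- Repeated members of a set system.

copies : (c : ℕ) → Subset n → Fin n → Subset c
copies c S e = if does (e ∈? S) then full else ∅

∣nbhd-copies∣≤ : ∀ c (S J : Subset n) → ∣ nbhd (copies c S) J ∣ ≤ c
∣nbhd-copies∣≤ c S J = ∣p∣≤n (nbhd (copies c S) J)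

nbhd-copies-⊆∅ : ∀ c (S J : Subset n) → (∀ {e} → e ∈ J → e ∉ S) → nbhd (copies c S) J ⊆ ∅
nbhd-copies-⊆∅ c S J disjoint = nbhd-⊆ (copies c S) J λ {e} e∈J → unmatched e (disjoint e∈J)
  where
  unmatched : ∀ e → e ∉ S → copies c S e ⊆ ∅
  unmatched e e∉S with e ∈? S
  ... | yes e∈S = contradiction e∈S e∉S
  ... | no _ = ⊆-refl

≤∣nbhd-copies∣ : ∀ c {S J : Subset n} {e} → e ∈ J → e ∈ S → c ≤ ∣ nbhd (copies c S) J ∣
≤∣nbhd-copies∣ c {S} {J} {e} e∈J e∈S = ≤-trans (≤-reflexive (sym (∣⊤∣≡n c)))
  (p⊆q⇒∣p∣≤∣q∣ {p = full} λ i∈ → ∈-nbhd⁺ (copies c S) e∈J (matched i∈))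
  where
  matched : full ⊆ copies c S e
  matched with e ∈? S
  ... | yes _ = ⊆-refl
  ... | no e∉S = contradiction e∈S e∉S

⊆∅⇒∣∣≡0 : {p : Subset n} → p ⊆ ∅ → ∣ p ∣ ≡ 0
⊆∅⇒∣∣≡0 {n} p⊆∅ = n≤0⇒n≡0 (≤-trans (p⊆q⇒∣p∣≤∣q∣ p⊆∅) (≤-reflexive (∣⊥∣≡0 n)))

-- Circuits and their closures.

module _ (ρ : RankFunction n) where
  open RankFunction ρ hiding (r; Independent; CyclicFlat; Flat; Cyclic)

  -- Removing elements while dependence persists ends at a circuit; `m` bounds the number of
  -- removals.
  circuit-fuel : ∀ m I → ∣ I ∣ ≤ m → ¬ Independent ρ I →
    ∃[ C ] (C ⊆ I × ¬ Independent ρ C × ∀ e → e ∈ C → Independent ρ (C - e))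
  circuit-fuel m I I≤m dep with any? (λ e → (e ∈? I) ×-dec ¬? (independent? (I - e)))
  circuit-fuel m I I≤m dep | no none =
    I , ⊆-refl , dep , λ e e∈I → decidable-stable (independent? (I - e)) λ dep′ → none (e , e∈I , dep′)
  circuit-fuel zero I I≤m dep | yes (e , e∈I , _) = contradiction (≤-trans (x∈p⇒∣p-x∣<∣p∣ e∈I) I≤m) λ ()
  circuit-fuel (suc m) I I≤m dep | yes (e , e∈I , dep′) =
    let C , C⊆ , rest = circuit-fuel m (I - e) (ℕ.s≤s⁻¹ (≤-trans (x∈p⇒∣p-x∣<∣p∣ e∈I) I≤m)) dep′
    in C , ⊆-trans C⊆ (p─q⊆p I ⁅ e ⁆) , rest

  -- A circuit `C` is cyclic: its rank is below `∣ C ∣`, while each `C - e` is independent of size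
  -- `∣ C ∣` minus one. Hence its closure is a cyclic flat of the same rank.
  dependent⇒cyclicFlat : ∀ I → ¬ Independent ρ I →
    ∃[ C ] (C ⊆ I × r ρ (cl C) < ∣ C ∣ × CyclicFlat ρ (cl C))
  dependent⇒cyclicFlat I dep =
    let C , C⊆I , depC , ind = circuit-fuel ∣ I ∣ I ≤-refl dep
        lt = ≤∧≢⇒< (r≤∣∣ C) depC
    in C , C⊆I , ≤-trans (s≤s (r-cl C)) lt
     , cl-cyclicFlat λ e e∈C → ℕ.s≤s⁻¹ (≤-trans lt (≤-trans (∣p∣≤1+∣p-x∣ C e) (s≤s (≤-reflexive (sym (ind e e∈C))))))

-- The presentation of M

module Glue
  (L₁ L₂ : FinLattice) (M : Matroid n) (f : Star L₁ L₂ → Subset n)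
  (f-cf : ∀ a → IsCyclicFlat M (f a)) (f-onto : ∀ X → IsCyclicFlat M X → ∃[ a ] f a ≡ X)
  (f-ord : ∀ a b → (_≤*_ L₁ L₂ a b) ⇔ (f a ⊆ f b)) where

  infix 4 _≼_
  _≼_ : Star L₁ L₂ → Star L₁ L₂ → Set
  _≼_ = _≤*_ L₁ L₂

  ≼⇒⊆ : ∀ a b → a ≼ b → f a ⊆ f b
  ≼⇒⊆ a b = Equivalence.to (f-ord a b)

  ⊆⇒≼ : ∀ a b → f a ⊆ f b → a ≼ b
  ⊆⇒≼ a b = Equivalence.from (f-ord a b)

  s0≼ : ∀ a → s0 ≼ a
  s0≼ s0        = tt
  s0≼ s1        = tt
  s0≼ (inl _ _) = tt
  s0≼ (inr _ _) = tt

  s1≼⇒≡ : ∀ a → s1 ≼ a → a ≡ s1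
  s1≼⇒≡ s1 _ = refl

  -- Both lattices are treated at once: `emb` is `inl` or `inr`, an order embedding whose image
  -- becomes an up-set once `s1` is added.
  module Side (L : FinLattice)
    (emb : (x : FinLattice.Carrier L) → ¬ (x ≡ FinLattice.top L) → Star L₁ L₂)
    (emb-ord : ∀ {x y p q} → FinLattice._≤L_ L x y ⇔ emb x p ≼ emb y q)
    (emb-up : ∀ {x p a} → emb x p ≼ a → a ≡ s1 ⊎ ∃[ y ] ∃[ q ] a ≡ emb y q)
    (s1⋠emb : ∀ {x p} → ¬ (s1 ≼ emb x p)) where
    open LatticeProperties L

    ι : Carrier → Star L₁ L₂
    ι x with x ≟L top
    ... | yes _ = s1
    ... | no x≢top = emb x x≢top

    ι-top : ι top ≡ s1
    ι-top with top ≟L top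
    ... | yes _ = refl
    ... | no top≢top = contradiction refl top≢top

    -- The two points may be built from different proofs that `x` is not `top`. These are never
    -- compared: the flats agree by inclusions both ways.
    f-ι-emb : ∀ x p → f (ι x) ≡ f (emb x p)
    f-ι-emb x p with x ≟L top
    ... | yes x≡top = contradiction x≡top p
    ... | no q = ⊆-antisym (≼⇒⊆ _ _ (Equivalence.to emb-ord ≤L-refl)) (≼⇒⊆ _ _ (Equivalence.to emb-ord ≤L-refl))

    ι-ord⇒ : ∀ x y → x ≤L y → ι x ≼ ι y
    ι-ord⇒ x y x≤y with x ≟L top | y ≟L top
    ... | _        | yes _  = tt
    ... | yes refl | no y≢  = contradiction (antisym (maximum y) x≤y) y≢
    ... | no _     | no _   = Equivalence.to emb-ord x≤y

    ι-ord⇐ : ∀ x y → ι x ≼ ι y → x ≤L y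
    ι-ord⇐ x y le with x ≟L top | y ≟L top
    ... | _     | yes refl = maximum x
    ... | yes _ | no _     = ⊥-elim (s1⋠emb le)
    ... | no _  | no _     = Equivalence.from emb-ord le

    ι-up : ∀ a → ι bot ≼ a → ∃[ x ] f (ι x) ≡ f a
    ι-up a le with bot ≟L top
    ... | yes _ = top , cong f (trans ι-top (sym (s1≼⇒≡ a le)))
    ... | no _ with emb-up {a = a} le
    ... | inj₁ refl = top , cong f ι-top
    ... | inj₂ (y , q , refl) = y , f-ι-emb y q

    upperPart : UpperPart L M
    upperPart = record
      { g      = f ∘ ι
      ; g-ord  = ord
      ; g-cf   = f-cf ∘ ι
      ; g-onto = onto
      }
      where
      ord : ∀ a b → (a ≤L b) ⇔ (f (ι a) ⊆ f (ι b))
      ord a b = f-ord (ι a) (ι b) ⇔-∘ mk⇔ (ι-ord⇒ a b) (ι-ord⇐ a b)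
      onto : ∀ X → IsCyclicFlat M X → f (ι bot) ⊆ X → ∃[ x ] f (ι x) ≡ X
      onto X cf sub with f-onto X cf
      ... | a , refl = ι-up a (⊆⇒≼ (ι bot) a sub)

    ι-bot≼ : ∀ a → ι bot ≼ a → a ≡ s1 ⊎ ∃[ y ] ∃[ q ] a ≡ emb y q
    ι-bot≼ a le with bot ≟L top
    ... | yes _ = inj₁ (s1≼⇒≡ a le)
    ... | no _ = emb-up {a = a} le

  inl-up : ∀ {x p a} → inl x p ≼ a → a ≡ s1 ⊎ ∃[ y ] ∃[ q ] a ≡ inl y q
  inl-up {a = s1}      _ = inj₁ refl
  inl-up {a = inl y q} _ = inj₂ (y , q , refl)

  inr-up : ∀ {x p a} → inr x p ≼ a → a ≡ s1 ⊎ ∃[ y ] ∃[ q ] a ≡ inr y q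
  inr-up {a = s1}      _ = inj₁ refl
  inr-up {a = inr y q} _ = inj₂ (y , q , refl)

  module S₁ = Side L₁ inl (mk⇔ id id) inl-up (λ ())
  module S₂ = Side L₂ inr (mk⇔ id id) inr-up (λ ())

  U Z₀ Z₁ Z₂ : Subset n
  U  = f s1
  Z₀ = f s0
  Z₁ = f (S₁.ι (FinLattice.bot L₁))
  Z₂ = f (S₂.ι (FinLattice.bot L₂))

  -- Above either bottom lie only `s1` and points of its own lattice, and the two lattices share no
  -- point.
  join-bots : ∀ a → Z₁ ⊆ f a → Z₂ ⊆ f a → a ≡ s1
  join-bots a Z₁⊆ Z₂⊆ with S₁.ι-bot≼ a (⊆⇒≼ _ a Z₁⊆) | S₂.ι-bot≼ a (⊆⇒≼ _ a Z₂⊆)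
  ... | inj₁ eq | _ = eq
  ... | inj₂ _  | inj₁ eq = eq
  ... | inj₂ (_ , _ , refl) | inj₂ (_ , _ , ())

  -- The four blocks of members and their counts.

  module _ {ρ : RankFunction n} (rep : Represents M ρ)
    {k₁} (Γ₁ : Fin n → Subset k₁)
    (upper₁ : ∀ x → ∣ nbhd Γ₁ (f (S₁.ι x)) ∣ + r ρ Z₁ ≤ r ρ (f (S₁.ι x)))
    (lower₁ : ∀ J → r ρ (J ∪ Z₁) ≤ ∣ nbhd Γ₁ J ∣ + r ρ Z₁)
    {k₂} (Γ₂ : Fin n → Subset k₂)
    (upper₂ : ∀ y → ∣ nbhd Γ₂ (f (S₂.ι y)) ∣ + r ρ Z₂ ≤ r ρ (f (S₂.ι y)))
    (lower₂ : ∀ J → r ρ (J ∪ Z₂) ≤ ∣ nbhd Γ₂ J ∣ + r ρ Z₂)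
    where
    private
      module ρ = RankFunction ρ
      rU = ρ.r U
      r₁ = ρ.r Z₁
      r₂ = ρ.r Z₂

    cyclicFlat⇒f : ∀ {X} → ρ.CyclicFlat X → ∃[ a ] f a ≡ X
    cyclicFlat⇒f cf = f-onto _ (cyclicFlat⇒isCyclicFlat rep cf)

    -- The closure of the empty set is a cyclic flat, so it contains the least one; thus `Z₀`
    -- consists of loops.
    r-Z₀ : ρ.r Z₀ ≤ 0
    r-Z₀ =
      let a , eq = cyclicFlat⇒f (ρ.cl-cyclicFlat {∅} λ e e∈ → ⊥-elim (∉⊥ e∈))
      in ≤-trans (ρ.r-mono (subst (Z₀ ⊆_) eq (≼⇒⊆ s0 _ (s0≼ a))))
           (≤-trans (ρ.r-cl ∅) (≤-trans (ρ.r≤∣∣ ∅) (≤-reflexive (∣⊥∣≡0 n))))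

    -- The closure of `Z₁ ∪ Z₂` is a cyclic flat above both bottoms, hence equals `U`.
    rU≤r-Z₁∪Z₂ : rU ≤ ρ.r (Z₁ ∪ Z₂)
    rU≤r-Z₁∪Z₂ =
      let cyc = λ a → proj₂ (isCyclicFlat⇒cyclicFlat rep (f-cf a))
          a , eq = cyclicFlat⇒f (ρ.cl-cyclicFlat (ρ.∪-cyclic
            (cyc (S₁.ι (FinLattice.bot L₁))) (cyc (S₂.ι (FinLattice.bot L₂)))))
          ⊆fa = subst (Z₁ ∪ Z₂ ⊆_) (sym eq) (ρ.⊆-cl (Z₁ ∪ Z₂))
          a≡s1 = join-bots a (⊆-trans (p⊆p∪q Z₂) ⊆fa) (⊆-trans (q⊆p∪q Z₁ Z₂) ⊆fa)
      in ≤-trans (≤-reflexive (cong ρ.r (trans (cong f (sym a≡s1)) eq))) (ρ.r-cl (Z₁ ∪ Z₂))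

    c : ℕ
    c = (r₁ + r₂) ∸ rU

    -- The subtraction in `c` is exact by submodularity for `Z₁` and `Z₂`.
    c+rU : c + rU ≡ r₁ + r₂
    c+rU = m∸n+n≡m (≤-trans rU≤r-Z₁∪Z₂ (≤-trans (m≤m+n _ _) (ρ.r-submod Z₁ Z₂)))

    Γ₃ : Fin n → Subset c
    Γ₃ = copies c (U ─ Z₀)

    -- Indices are the ground elements: the member at `e` is the singleton of `e` if `e` lies
    -- outside `U`, and empty otherwise.
    Γ₄ : Fin n → Subset n
    Γ₄ e = ⁅ e ⁆ ─ U

    Γ : Fin n → Subset (k₁ + (k₂ + (c + n)))
    Γ e = Γ₁ e ++ (Γ₂ e ++ (Γ₃ e ++ Γ₄ e))

    ∣nbhd-Γ∣ : ∀ J → ∣ nbhd Γ J ∣ ≡ ∣ nbhd Γ₁ J ∣ + (∣ nbhd Γ₂ J ∣ + (∣ nbhd Γ₃ J ∣ + ∣ nbhd Γ₄ J ∣))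
    ∣nbhd-Γ∣ J =
      trans (∣nbhd-++∣ Γ₁ _ J) (cong (∣ nbhd Γ₁ J ∣ +_)
      (trans (∣nbhd-++∣ Γ₂ _ J) (cong (∣ nbhd Γ₂ J ∣ +_) (∣nbhd-++∣ Γ₃ Γ₄ J))))

    f⊆U : ∀ a → f a ⊆ U
    f⊆U a = ≼⇒⊆ a s1 tt

    nbhd-Γ₄-⊆U : ∀ {J} → J ⊆ U → ∣ nbhd Γ₄ J ∣ ≡ 0
    nbhd-Γ₄-⊆U {J} J⊆U = ⊆∅⇒∣∣≡0 (nbhd-⊆ Γ₄ J λ {e} e∈J i∈ → ⊥-elim
      (x∈p─q⇒x∉q ⁅ e ⁆ U i∈ (subst (_∈ U) (sym (x∈⁅y⁆⇒x≡y e (p─q⊆p ⁅ e ⁆ U i∈))) (J⊆U e∈J))))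

    Γ₁-≤ : ∀ {X} x → X ⊆ f (S₁.ι x) → ∣ nbhd Γ₁ X ∣ + r₁ ≤ ρ.r (f (S₁.ι x))
    Γ₁-≤ x X⊆ = ≤-trans (+-monoˡ-≤ r₁ (p⊆q⇒∣p∣≤∣q∣ (nbhd-mono Γ₁ X⊆))) (upper₁ x)

    Γ₂-≤ : ∀ {X} y → X ⊆ f (S₂.ι y) → ∣ nbhd Γ₂ X ∣ + r₂ ≤ ρ.r (f (S₂.ι y))
    Γ₂-≤ y X⊆ = ≤-trans (+-monoˡ-≤ r₂ (p⊆q⇒∣p∣≤∣q∣ (nbhd-mono Γ₂ X⊆))) (upper₂ y)

    -- Inside `U` the third block counts at most `c` and the fourth nothing; `c + rU` is then traded
    -- for `r₁ + r₂`, which is shared between the first two blocks.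
    count : ∀ {X x} → X ⊆ U → ∣ nbhd Γ₁ X ∣ + r₁ + (∣ nbhd Γ₂ X ∣ + r₂) ≤ x + rU → ∣ nbhd Γ X ∣ ≤ x
    count {X} {x} X⊆U bound = +-cancelʳ-≤ rU _ _ (begin
      ∣ nbhd Γ X ∣ + rU   ≡⟨ cong (_+ rU) (∣nbhd-Γ∣ X) ⟩
      N₁ + (N₂ + (∣ nbhd Γ₃ X ∣ + ∣ nbhd Γ₄ X ∣)) + rU
        ≤⟨ +-monoˡ-≤ rU (+-monoʳ-≤ N₁ (+-monoʳ-≤ N₂ (+-mono-≤ (∣nbhd-copies∣≤ c (U ─ Z₀) X) (≤-reflexive (nbhd-Γ₄-⊆U X⊆U))))) ⟩
      N₁ + (N₂ + (c + 0)) + rU   ≡⟨ cong (λ m → N₁ + (N₂ + m) + rU) (+-identityʳ c) ⟩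
      N₁ + (N₂ + c) + rU   ≡⟨ cong (_+ rU) (+-assoc N₁ N₂ c) ⟨
      N₁ + N₂ + c + rU   ≡⟨ +-assoc (N₁ + N₂) c rU ⟩
      N₁ + N₂ + (c + rU)   ≡⟨ cong (N₁ + N₂ +_) c+rU ⟩
      N₁ + N₂ + (r₁ + r₂)   ≡⟨ +-interchange N₁ N₂ r₁ r₂ ⟩
      N₁ + r₁ + (N₂ + r₂)   ≤⟨ bound ⟩
      x + rU   ∎)
      where
      open ≤-Reasoning
      N₁ = ∣ nbhd Γ₁ X ∣
      N₂ = ∣ nbhd Γ₂ X ∣

    ≤rU₁ : ∀ a → ∣ nbhd Γ₁ (f a) ∣ + r₁ ≤ rU
    ≤rU₁ a = subst (λ b → ∣ nbhd Γ₁ (f a) ∣ + r₁ ≤ ρ.r (f b)) S₁.ι-top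
      (Γ₁-≤ (FinLattice.top L₁) (subst (λ b → f a ⊆ f b) (sym S₁.ι-top) (f⊆U a)))

    ≤rU₂ : ∀ a → ∣ nbhd Γ₂ (f a) ∣ + r₂ ≤ rU
    ≤rU₂ a = subst (λ b → ∣ nbhd Γ₂ (f a) ∣ + r₂ ≤ ρ.r (f b)) S₂.ι-top
      (Γ₂-≤ (FinLattice.top L₂) (subst (λ b → f a ⊆ f b) (sym S₂.ι-top) (f⊆U a)))

    -- On a flat of one side, the block of that side is bounded by the rank of the flat and the
    -- other block by `rU`, which `count` cancels.
    ∣nbhd-Γ∣≤r : ∀ a → ∣ nbhd Γ (f a) ∣ ≤ ρ.r (f a)
    ∣nbhd-Γ∣≤r s1 = count ⊆-refl (+-mono-≤ (≤rU₁ s1) (≤rU₂ s1))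
    ∣nbhd-Γ∣≤r (inl x p) = count (f⊆U (inl x p)) (+-mono-≤
      (subst (λ X → ∣ nbhd Γ₁ X ∣ + r₁ ≤ ρ.r X) (S₁.f-ι-emb x p) (upper₁ x)) (≤rU₂ (inl x p)))
    ∣nbhd-Γ∣≤r (inr y p) = count (f⊆U (inr y p)) (≤-trans (+-mono-≤ (≤rU₁ (inr y p))
      (subst (λ X → ∣ nbhd Γ₂ X ∣ + r₂ ≤ ρ.r X) (S₂.f-ι-emb y p) (upper₂ y))) (≤-reflexive (+-comm rU _)))
    -- `Z₀` lies in both `Z₁` and `Z₂`, which have no neighbours in their respective blocks; the
    -- third block leaves `Z₀` out.
    ∣nbhd-Γ∣≤r s0 = ≤-trans (≤-reflexive (trans (∣nbhd-Γ∣ Z₀) (cong₂ _+_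
      (zero₁ (Γ₁-≤ (FinLattice.bot L₁) (≼⇒⊆ s0 _ (s0≼ (S₁.ι (FinLattice.bot L₁))))))
      (cong₂ _+_ (zero₁ (Γ₂-≤ (FinLattice.bot L₂) (≼⇒⊆ s0 _ (s0≼ (S₂.ι (FinLattice.bot L₂))))))
      (cong₂ _+_ (⊆∅⇒∣∣≡0 (nbhd-copies-⊆∅ c (U ─ Z₀) Z₀ λ e∈Z₀ e∈ → x∈p─q⇒x∉q U Z₀ e∈ e∈Z₀))
        (nbhd-Γ₄-⊆U (f⊆U s0))))))) z≤n
      where
      zero₁ : ∀ {m x} → m + x ≤ x → m ≡ 0
      zero₁ {m} {x} le = n≤0⇒n≡0 (+-cancelʳ-≤ x m 0 le)

    -- Submodularity for `J′ ∪ Z₁` and `J′ ∪ Z₂`, whose union has rank at least `rU` and whose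
    -- intersection contains `J′`. The element `e` is no loop, hence outside `Z₀`, and so secures
    -- all `c` copies.
    ∣J∩U∣≤ : ∀ {J e} → ρ.Independent J → e ∈ J ∩ U → ∣ J ∩ U ∣ ≤ ∣ nbhd Γ₁ J ∣ + (∣ nbhd Γ₂ J ∣ + ∣ nbhd Γ₃ J ∣)
    ∣J∩U∣≤ {J} {e} ind e∈ = +-cancelʳ-≤ rU _ _ (begin
      ∣ J′ ∣ + rU                               ≡⟨ cong (_+ rU) (ρ.independent-⊆ (p∩q⊆p J U) ind) ⟨
      ρ.r J′ + rU                               ≡⟨ +-comm (ρ.r J′) rU ⟩
      rU + ρ.r J′                               ≤⟨ +-mono-≤ rU≤r-Z₁∪Z₂ ≤-refl ⟩
      ρ.r (Z₁ ∪ Z₂) + ρ.r J′                    ≤⟨ +-mono-≤ (ρ.r-mono (∪-mono (q⊆p∪q J′ Z₁) (q⊆p∪q J′ Z₂)))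
                                                    (ρ.r-mono λ x∈ → x∈p∩q⁺ (p⊆p∪q Z₁ x∈ , p⊆p∪q Z₂ x∈)) ⟩
      ρ.r ((J′ ∪ Z₁) ∪ (J′ ∪ Z₂)) + ρ.r ((J′ ∪ Z₁) ∩ (J′ ∪ Z₂)) ≤⟨ ρ.r-submod (J′ ∪ Z₁) (J′ ∪ Z₂) ⟩
      ρ.r (J′ ∪ Z₁) + ρ.r (J′ ∪ Z₂)             ≤⟨ +-mono-≤ (lower₁ J′) (lower₂ J′) ⟩
      (∣ nbhd Γ₁ J′ ∣ + r₁) + (∣ nbhd Γ₂ J′ ∣ + r₂)
        ≤⟨ +-mono-≤ (+-monoˡ-≤ r₁ (p⊆q⇒∣p∣≤∣q∣ (nbhd-mono Γ₁ (p∩q⊆p J U))))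
                    (+-monoˡ-≤ r₂ (p⊆q⇒∣p∣≤∣q∣ (nbhd-mono Γ₂ (p∩q⊆p J U)))) ⟩
      (N₁ + r₁) + (N₂ + r₂)                     ≡⟨ +-interchange N₁ r₁ N₂ r₂ ⟩
      N₁ + N₂ + (r₁ + r₂)                       ≡⟨ cong (N₁ + N₂ +_) c+rU ⟨
      N₁ + N₂ + (c + rU)                        ≡⟨ +-assoc (N₁ + N₂) c rU ⟨
      N₁ + N₂ + c + rU                          ≡⟨ cong (_+ rU) (+-assoc N₁ N₂ c) ⟩
      N₁ + (N₂ + c) + rU
        ≤⟨ +-monoˡ-≤ rU (+-monoʳ-≤ N₁ (+-monoʳ-≤ N₂ (≤∣nbhd-copies∣ c e∈J (x∈p∧x∉q⇒x∈p─q e∈U e∉Z₀)))) ⟩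
      N₁ + (N₂ + ∣ nbhd Γ₃ J ∣) + rU            ∎)
      where
      open ≤-Reasoning
      J′ = J ∩ U
      N₁ = ∣ nbhd Γ₁ J ∣
      N₂ = ∣ nbhd Γ₂ J ∣
      e∈J = p∩q⊆p J U e∈
      e∈U = p∩q⊆q J U e∈
      e∉Z₀ : e ∉ Z₀
      e∉Z₀ e∈Z₀ = contradiction
        (subst (_≤ 0) (trans (ρ.independent-⊆ (⁅⁆-⊆ e∈J) ind) (∣⁅x⁆∣≡1 e))
          (≤-trans (ρ.r-mono (⁅⁆-⊆ e∈Z₀)) r-Z₀)) λ ()

    hall-Γ : ∀ {I} → ρ.Independent I → HallCondition Γ I
    hall-Γ {I} indI J J⊆I = begin
      ∣ J ∣                                                      ≡⟨ ∣p∩q∣+∣p─q∣≡∣p∣ J U ⟨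
      ∣ J ∩ U ∣ + ∣ J ─ U ∣                                      ≤⟨ +-mono-≤ inside-U (p⊆q⇒∣p∣≤∣q∣ outside-U) ⟩
      (N₁ + (N₂ + N₃)) + ∣ nbhd Γ₄ J ∣                           ≡⟨ +-assoc N₁ (N₂ + N₃) _ ⟩
      N₁ + ((N₂ + N₃) + ∣ nbhd Γ₄ J ∣)                           ≡⟨ cong (N₁ +_) (+-assoc N₂ N₃ _) ⟩
      N₁ + (N₂ + (N₃ + ∣ nbhd Γ₄ J ∣))                           ≡⟨ ∣nbhd-Γ∣ J ⟨
      ∣ nbhd Γ J ∣                                               ∎
      where
      open ≤-Reasoning
      N₁ = ∣ nbhd Γ₁ J ∣
      N₂ = ∣ nbhd Γ₂ J ∣
      N₃ = ∣ nbhd Γ₃ J ∣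
      inside-U : ∣ J ∩ U ∣ ≤ N₁ + (N₂ + N₃)
      inside-U with nonempty? (J ∩ U)
      ... | yes (e , e∈) = ∣J∩U∣≤ (ρ.independent-⊆ J⊆I indI) e∈
      ... | no empty = ≤-trans (≤-reflexive (trans (cong ∣_∣ (Empty-unique empty)) (∣⊥∣≡0 n))) z≤n
      outside-U : J ─ U ⊆ nbhd Γ₄ J
      outside-U {e} e∈ = ∈-nbhd⁺ Γ₄ (p─q⊆p J U e∈) (x∈p∧x∉q⇒x∈p─q (x∈⁅x⁆ e) (x∈p─q⇒x∉q J U e∈))

    presents-Γ : Presents Γ ρ
    presents-Γ I = mk⇔ matched independent
      where
      matched : ρ.Independent I → ∃ (Matching Γ I)
      -- The default partner of `e` is its own index in the last block.
      matched ind = hall Γ I (λ e → k₁ ↑ʳ (k₂ ↑ʳ (c ↑ʳ e))) (hall-Γ ind)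
      independent : ∃ (Matching Γ I) → ρ.Independent I
      -- A dependent `I` contains a circuit `C` larger than the rank of the cyclic flat `cl C`, but
      -- that flat has no more neighbours than its rank.
      independent (φ , matching) = decidable-stable (ρ.independent? I) λ dep →
        let C , C⊆I , lt , cf = dependent⇒cyclicFlat ρ I dep
            a , eq = cyclicFlat⇒f cf
        in <⇒≱ lt (≤-trans (matching⇒∣∣≤ Γ I φ matching C C⊆I)
             (≤-trans (p⊆q⇒∣p∣≤∣q∣ (nbhd-mono Γ (⊆-trans (ρ.⊆-cl C) (⊆-reflexive (sym eq)))))
               (≤-trans (∣nbhd-Γ∣≤r a) (≤-reflexive (cong ρ.r eq)))))

theorem5p4 : (L₁ L₂ : FinLattice) → IsTrLattice L₁ → IsTrLattice L₂ →
    IsTrOrder (Star L₁ L₂) (_≤*_ L₁ L₂)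
theorem5p4 L₁ L₂ tr₁ tr₂ n M (f , f-cf , f-onto , _ , f-ord) =
  let k₁ , Γ₁ , upper₁ , lower₁ = upperPart-nbhds S₁.upperPart rep tr₁
      k₂ , Γ₂ , upper₂ , lower₂ = upperPart-nbhds S₂.upperPart rep tr₂
  in presents⇒transversal _ rep (presents-Γ rep Γ₁ upper₁ lower₁ Γ₂ upper₂ lower₂)
  where
  open Glue L₁ L₂ M f f-cf f-onto f-ord
  rep = rankFunction-represents M (tr⇒indep? S₁.upperPart tr₁)
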